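{- Let $S$ be an extension of $\mathrm{HA}^\omega$ with a base interpretation of $\mathcal L_S^{\mathcal I}$ that uses the bounding interpretation at the ground type $\mathbb N$. Suppose that the $B$-restricted quantifiers, for a formula $B(x^\sigma,\boldsymbol y)$, are semi-uniform and that $C(x,n^{\mathbb N})$ is a formula of the source language with no positive $\mathcal I$-witnesses. Then the principle $$\forall k^{\mathbb N}\,\exists x\lhd_\sigma B(\boldsymbol y)\,\forall n\le k\,C(x,n)\ \to\ \exists x\lhd_\sigma B(\boldsymbol y)\,\forall n^{\mathbb N}\,C(x,n)$$ is $\mathcal I$-interpretable.
   Context: Source. $\mathrm{HA}^\omega$ is Heyting arithmetic in all finite types generated by $\sigma\to\tau$ from ground types including $\mathbb N$ and $\mathbb B$, with combinators, $0$, successor, recursors, Boolean constants and conditionals, logical equalities $\equiv_\sigma$ at all types, and the usual axioms; $S$ is an extension of it (possibly with further types, constants, relation symbols and axioms) in the language $\mathcal L_S$. Formulas use $\bot,\wedge,\to,\forall x^\sigma,\exists x^\sigma$ and restricted quantifiers (below). $n\le k$ abbreviates a quantifier-free equation of type $\mathbb N$. Target. The target theory $T$ has types and terms including those of $\mathcal L_S$, and witnessing types, including $\mathbb N$, closed under $\rho\to\tau$ and $\rho^*$ (non-empty finite subsets), with combinators, recursors, singleton, union, indexed union, membership and the maximum functional $\mathrm m:\mathbb N^*\to\mathbb N$; it proves the usual elementary facts about these, natural numbers and equality (e.g. $T$ may be the set of truths in the full set-theoretic structure). Boldface letters are (possibly empty) tuples; $\forall\boldsymbol b\in\boldsymbol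 B$ is componentwise. $\mathcal L_S^{\mathcal I}$ adds a unary predicate $\mathcal I_\sigma(x^\sigma)$ for each type. A base interpretation assigns to each relation symbol $R$ tuples of witnessing types $\boldsymbol\tau_R^+,\boldsymbol\tau_R^-$ and a relation $\langle R(\boldsymbol x)\rangle^{\boldsymbol c}_{\boldsymbol d}$ of the target language ($\boldsymbol c:\boldsymbol\tau_R^+$, $\boldsymbol d:\boldsymbol\tau_R^-$); $\langle x\equiv_\sigma y\rangle$ is $x=y$ without witnesses. It uses the bounding interpretation at $\mathbb N$: $\langle\mathcal I_{\mathbb N}(x)\rangle^m$ is $x\le m$ ($m:\mathbb N$, no negative witnesses). $\mathcal U$-interpretation: $\langle\bot\rangle:\equiv\bot$; $\langle A\wedge B\rangle^{\boldsymbol a,\boldsymbol c}_{\boldsymbol b,\boldsymbol d}:\equiv\langle A\rangle^{\boldsymbol a}_{\boldsymbol b}\wedge\langle B\rangle^{\boldsymbol c}_{\boldsymbol d}$; $\langle A\to B\rangle^{\boldsymbol f,\boldsymbol g}_{\boldsymbol a,\boldsymbol d}:\equiv\forall\boldsymbol b\in\boldsymbol g\boldsymbol a\boldsymbol d\,\langle A\rangle^{\boldsymbol a}_{\boldsymbol b}\to\langle B\rangle^{\boldsymbol f\boldsymbol a}_{\boldsymbol d}$; $\langle\forall xA\rangle^{\boldsymbol a}_{\boldsymbol b}:\equiv\forall x\langle A\rangle^{\boldsymbol a}_{\boldsymbol b}$; $\langle\exists xA\rangle^{\boldsymbol a}_{\boldsymbol B}:\equiv\exists x\forall\boldsymbol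 b\in\boldsymbol B\langle A\rangle^{\boldsymbol a}_{\boldsymbol b}$. $A(\boldsymbol x)$ is $\mathcal U$-interpretable if there are closed witnessing terms $\boldsymbol t$ with $T\vdash\forall\boldsymbol b\langle A(\boldsymbol x)\rangle^{\boldsymbol t}_{\boldsymbol b}$. Restricted quantifiers. For a formula $B(x^\sigma,\boldsymbol y)$ there are primitive quantifiers $\forall x\lhd_\sigma B(\boldsymbol y)\,A(x)$, $\exists x\lhd_\sigma B(\boldsymbol y)\,A(x)$ with axioms stating their equivalence with $\forall x^\sigma(B(x,\boldsymbol y)\to A(x))$, $\exists x^\sigma(B(x,\boldsymbol y)\wedge A(x))$. The bounded quantifier $\forall n\le k$ is the restricted quantifier for the formula $n\le k$. Relativization $A^{\mathcal I}$ commutes with connectives, $(\forall x^\sigma A)^{\mathcal I}:\equiv\forall x^\sigma(\mathcal I_\sigma(x)\to A^{\mathcal I})$, $(\exists x^\sigma A)^{\mathcal I}:\equiv\exists x^\sigma(\mathcal I_\sigma(x)\wedge A^{\mathcal I})$, $(\forall x\lhd_\sigma B(\boldsymbol y)A)^{\mathcal I}:\equiv\forall x^\sigma(B(x,\boldsymbol y)^{\mathcal I}\to A^{\mathcal I})$, $(\exists x\lhd_\sigma B(\boldsymbol y)A)^{\mathcal I}:\equiv\exists x^\sigma(B(x,\boldsymbol y)^{\mathcal I}\wedge A^{\mathcal I})$. Put $|A|^{\boldsymbol a}_{\boldsymbol b}:\equiv\langle A^{\mathcal I}\rangle^{\boldsymbol a}_{\boldsymbol b}$; $\boldsymbol a$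 are the positive and $\boldsymbol b$ the negative $\mathcal I$-witnesses of $A$; $A$ has no positive $\mathcal I$-witnesses if the tuple $\boldsymbol a$ is empty. A formula $A(\boldsymbol x)$ is $\mathcal I$-interpretable if $\forall\boldsymbol x(\mathcal I(\boldsymbol x)\to A(\boldsymbol x)^{\mathcal I})$ is $\mathcal U$-interpretable. $B(x^\sigma,\boldsymbol y^{\boldsymbol\tau})$ subsumes $\mathcal I_\sigma(x)$ if $\forall\boldsymbol y(\mathcal I_{\boldsymbol\tau}(\boldsymbol y)\to\forall x^\sigma(B(x,\boldsymbol y)^{\mathcal I}\to\mathcal I_\sigma(x)))$ is $\mathcal U$-interpretable. The $B$-restricted quantifiers are semi-uniform if $B$ subsumes $\mathcal I_\sigma(x)$ and $B$ has no positive $\mathcal I$-witnesses. -}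

module Defs where

open import Data.List.Base using (List; []; _∷_; _++_; map; foldr)
open import Data.List.Membership.Propositional using (_∈_)
open import Data.List.Relation.Unary.All as All using (All; []; _∷_)
open import Data.List.Relation.Unary.All.Properties using (++⁺; ++⁻ˡ; ++⁻ʳ; map⁺; map⁻)
open import Data.List.Relation.Unary.Any using (here; there)
open import Data.Product.Base using (Σ; _×_; _,_)
open import Data.Unit.Base using (⊤; tt)
open import Relation.Binary.PropositionalEquality.Core using (_≡_; refl)

infixr 20 _⇒_
infix  21 _*

-- All types of the target theory T.  The types of the source language form a
-- subclass of these (`Sort` below) and the witnessing types form another
-- (`Wit`); ℕ belongs to both.  `Base` holds the further ground types, and any
-- further type that is neither a function type nor a type σ * may also be
-- placed there.
data Type (Base : Set) : Set where
  nat bool : Type Base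
  base     : Base → Type Base
  _⇒_      : Type Base → Type Base → Type Base
  _*       : Type Base → Type Base

module _ {Base : Set} where

  Ty : Set
  Ty = Type Base

  infixr 20 _⇒*_

  -- ρ₁ ⇒ … ⇒ ρₙ ⇒ τ
  _⇒*_ : List Ty → Ty → Ty
  ρs ⇒* τ = foldr _⇒_ τ ρs

record TermSig (Base : Set) : Set₁ where
  field
    Sort      : Type Base → Set
    sort-nat  : Sort nat
    sort-bool : Sort bool
    sort-⇒    : ∀ {σ τ} → Sort σ → Sort τ → Sort (σ ⇒ τ)
    Extra     : Type Base → Set

module _ {Base : Set} (L : TermSig Base) where
  open TermSig L

  -- Proofs of `Sort σ` are irrelevant: there is one K per pair of types, etc.
  data Const : Ty → Set where
    K     : ∀ {σ τ} → .(Sort σ) → .(Sort τ) → Const (σ ⇒ τ ⇒ σ)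
    S     : ∀ {ρ σ τ} → .(Sort ρ) → .(Sort σ) → .(Sort τ) →
            Const ((ρ ⇒ σ ⇒ τ) ⇒ (ρ ⇒ σ) ⇒ ρ ⇒ τ)
    zero  : Const nat
    suc   : Const (nat ⇒ nat)
    rec   : ∀ {σ} → .(Sort σ) → Const (σ ⇒ (nat ⇒ σ ⇒ σ) ⇒ nat ⇒ σ)
    true  : Const bool
    false : Const bool
    cond  : ∀ {σ} → .(Sort σ) → Const (bool ⇒ σ ⇒ σ ⇒ σ)
    extra : ∀ {σ} → Extra σ → Const σ

  infixl 25 _·_

  data Term (Γ : List Ty) : Ty → Set where
    var : ∀ {τ} → τ ∈ Γ → Term Γ τ
    con : ∀ {τ} → Const τ → Term Γ τ
    _·_ : ∀ {σ τ} → Term Γ (σ ⇒ τ) → Term Γ σ → Term Γ τ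

  -- Tuples of terms of types Γ over Δ; also the substitutions from Γ to Δ.
  Tms : List Ty → List Ty → Set
  Tms Δ Γ = All (Term Δ) Γ

module _ {Base : Set} {L : TermSig Base} where
  open TermSig L

  subᵗ : ∀ {Γ Δ τ} → Tms L Δ Γ → Term L Γ τ → Term L Δ τ
  subᵗ γ (var i) = All.lookup γ i
  subᵗ γ (con c) = con c
  subᵗ γ (s · t) = subᵗ γ s · subᵗ γ t

  subˢ : ∀ {Γ Δ Θ} → Tms L Δ Γ → Tms L Γ Θ → Tms L Δ Θ
  subˢ γ = All.map (subᵗ γ)

  ids : ∀ {Γ} → Tms L Γ Γ
  ids = All.tabulate var

  wks : ∀ {Γ} Θ → Tms L (Θ ++ Γ) Γ
  wks Θ = ++⁻ʳ Θ ids

  wk₁ : ∀ {Γ σ} → Tms L (σ ∷ Γ) Γ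
  wk₁ {σ = σ} = wks (σ ∷ [])

  lift : ∀ {Γ Δ σ} → Tms L Δ Γ → Tms L (σ ∷ Δ) (σ ∷ Γ)
  lift γ = var (here refl) ∷ subˢ wk₁ γ

  v₀ : ∀ {Γ σ} → Term L (σ ∷ Γ) σ
  v₀ = var (here refl)

  v₁ : ∀ {Γ σ τ} → Term L (τ ∷ σ ∷ Γ) σ
  v₁ = var (there (here refl))

  v₂ : ∀ {Γ ρ σ τ} → Term L (ρ ∷ τ ∷ σ ∷ Γ) σ
  v₂ = var (there (there (here refl)))

  -- (f₁ … fₙ) a = (f₁ a … fₙ a) for tuples
  app₁ : ∀ {Δ τ} ρs → Term L Δ (ρs ⇒* τ) → Tms L Δ ρs → Term L Δ τ
  app₁ []       f []       = f
  app₁ (ρ ∷ ρs) f (a ∷ as) = app₁ ρs (f · a) as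

  app : ∀ {Δ} ρs {A : Set} {u : A → Ty} {xs : List A} →
        Tms L Δ (map (λ x → ρs ⇒* u x) xs) → Tms L Δ ρs → Tms L Δ (map u xs)
  app ρs fs as = map⁺ (All.map (λ f → app₁ ρs f as) (map⁻ fs))

  -- Truncated subtraction: n ∸ 0 = n and n ∸ (k + 1) = pred (n ∸ k),
  -- where pred 0 = 0 and pred (k + 1) = k.
  pred : ∀ {Γ} → Term L Γ (nat ⇒ nat)
  pred = con (rec sort-nat) · con zero · con (K sort-nat sort-nat)

  monus : ∀ {Γ} → Term L Γ nat → Term L Γ nat → Term L Γ nat
  monus n k =
    con (rec sort-nat) · n · (con (K (sort-⇒ sort-nat sort-nat) sort-nat) · pred) · k

-- Only `restricted` formulas may contain the restricted quantifiers.
data Kind : Set where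
  plain restricted : Kind

module _ {Base : Set} (L : TermSig Base) (R : List (Type Base) → Set) where
  open TermSig L

  infix  15 _≈_
  infixr 14 _∧_
  infixr 13 _⊃_

  data Formula : Kind → List Ty → Set where
    rel  : ∀ {k Γ Θ} → R Θ → Tms L Γ Θ → Formula k Γ
    _≈_  : ∀ {k Γ σ} → Term L Γ σ → Term L Γ σ → Formula k Γ
    ⊥′   : ∀ {k Γ} → Formula k Γ
    _∧_  : ∀ {k Γ} → Formula k Γ → Formula k Γ → Formula k Γ
    _⊃_  : ∀ {k Γ} → Formula k Γ → Formula k Γ → Formula k Γ
    ∀′   : ∀ {k Γ σ} → .(Sort σ) → Formula k (σ ∷ Γ) → Formula k Γ
    ∃′   : ∀ {k Γ σ} → .(Sort σ) → Formula k (σ ∷ Γ) → Formula k Γ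
    -- ∀◁ s B A is ∀x◁B A(x)
    ∀◁   : ∀ {Γ σ} → .(Sort σ) → Formula restricted (σ ∷ Γ) →
           Formula restricted (σ ∷ Γ) → Formula restricted Γ
    ∃◁   : ∀ {Γ σ} → .(Sort σ) → Formula restricted (σ ∷ Γ) →
           Formula restricted (σ ∷ Γ) → Formula restricted Γ

module _ {Base : Set} {L : TermSig Base} {R : List (Type Base) → Set} where
  open TermSig L

  sub : ∀ {k Γ Δ} → Tms L Δ Γ → Formula L R k Γ → Formula L R k Δ
  sub γ (rel r ts)  = rel r (subˢ γ ts)
  sub γ (s ≈ t)     = subᵗ γ s ≈ subᵗ γ t
  sub γ ⊥′          = ⊥′
  sub γ (A ∧ B)     = sub γ A ∧ sub γ B
  sub γ (A ⊃ B)     = sub γ A ⊃ sub γ B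
  sub γ (∀′ s A)    = ∀′ s (sub (lift γ) A)
  sub γ (∃′ s A)    = ∃′ s (sub (lift γ) A)
  sub γ (∀◁ s B A)  = ∀◁ s (sub (lift γ) B) (sub (lift γ) A)
  sub γ (∃◁ s B A)  = ∃◁ s (sub (lift γ) B) (sub (lift γ) A)

  wk : ∀ {k Γ σ} → Formula L R k Γ → Formula L R k (σ ∷ Γ)
  wk = sub wk₁

  _[_] : ∀ {k Γ σ} → Formula L R k (σ ∷ Γ) → Term L Γ σ → Formula L R k Γ
  A [ t ] = sub (t ∷ ids) A

  ⊤′ : ∀ {k Γ} → Formula L R k Γ
  ⊤′ = ⊥′ ⊃ ⊥′

  ¬′ : ∀ {k Γ} → Formula L R k Γ → Formula L R k Γ
  ¬′ A = A ⊃ ⊥′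

  infix 12 _⇔′_

  _⇔′_ : ∀ {k Γ} → Formula L R k Γ → Formula L R k Γ → Formula L R k Γ
  A ⇔′ B = (A ⊃ B) ∧ (B ⊃ A)

  infix 15 _≤_

  _≤_ : ∀ {k Γ} → Term L Γ nat → Term L Γ nat → Formula L R k Γ
  n ≤ k = monus n k ≈ con zero

  close : ∀ {k Γ} → All Sort Γ → Formula L R k Γ → Formula L R k []
  close []       A = A
  close (s ∷ ss) A = close ss (∀′ s A)

module _ {Base : Set} (L : TermSig Base) (R : List (Type Base) → Set) where
  open TermSig L

  private
    Fm : List Ty → Set
    Fm = Formula L R restricted

  -- The axioms of HAω beyond those of intuitionistic logic, as schemata with free
  -- variables.
  data HAω {Γ : List Ty} : Fm Γ → Set where
    ≈-refl   : ∀ {σ} (t : Term L Γ σ) → HAω (t ≈ t)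
    ≈-subst  : ∀ {σ} (s t : Term L Γ σ) (A : Fm (σ ∷ Γ)) →
               HAω (s ≈ t ⊃ A [ s ] ⊃ A [ t ])
    K-eq     : ∀ {σ τ} .(p : Sort σ) .(q : Sort τ) s t → HAω (con (K p q) · s · t ≈ s)
    S-eq     : ∀ {ρ σ τ} .(p : Sort ρ) .(q : Sort σ) .(r : Sort τ) s t u →
               HAω (con (S p q r) · s · t · u ≈ s · u · (t · u))
    rec-zero : ∀ {σ} .(p : Sort σ) s t → HAω (con (rec p) · s · t · con zero ≈ s)
    rec-suc  : ∀ {σ} .(p : Sort σ) s t n →
               HAω (con (rec p) · s · t · (con suc · n) ≈ t · n · (con (rec p) · s · t · n))
    cond-tt  : ∀ {σ} .(p : Sort σ) s t → HAω (con (cond p) · con true · s · t ≈ s)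
    cond-ff  : ∀ {σ} .(p : Sort σ) s t → HAω (con (cond p) · con false · s · t ≈ t)
    true≉    : HAω (¬′ (con true ≈ con false))
    bool-ind : (A : Fm (bool ∷ Γ)) →
               HAω (A [ con true ] ⊃ A [ con false ] ⊃ ∀′ sort-bool A)
    zero≉    : ∀ n → HAω (¬′ (con suc · n ≈ con zero))
    suc-inj  : ∀ m n → HAω (con suc · m ≈ con suc · n ⊃ m ≈ n)
    nat-ind  : (A : Fm (nat ∷ Γ)) →
               HAω (A [ con zero ] ⊃
                    ∀′ sort-nat (A ⊃ sub (con suc · v₀ ∷ wk₁) A) ⊃ ∀′ sort-nat A)
    ∀◁-eq    : ∀ {σ} .(p : Sort σ) (B A : Fm (σ ∷ Γ)) → HAω (∀◁ p B A ⇔′ ∀′ p (B ⊃ A))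
    ∃◁-eq    : ∀ {σ} .(p : Sort σ) (B A : Fm (σ ∷ Γ)) → HAω (∃◁ p B A ⇔′ ∃′ p (B ∧ A))

record SourceTheory (Base : Set) : Set₁ where
  field
    sig   : TermSig Base
    Rel   : List (Type Base) → Set
    Axiom : ∀ {Γ} → Formula sig Rel restricted Γ → Set
    HAω⊆  : ∀ {Γ} {A : Formula sig Rel restricted Γ} → HAω sig Rel A → Axiom A
  open TermSig sig public

  -- The relation symbols of the language with the predicates 𝓘_σ.
  data Rel𝓘 : List (Type Base) → Set where
    old : ∀ {Θ} → Rel Θ → Rel𝓘 Θ
    𝓘   : ∀ {σ} → .(Sort σ) → Rel𝓘 (σ ∷ [])

  SFm IFm : List (Type Base) → Set
  SFm = Formula sig Rel restricted
  IFm = Formula sig Rel𝓘 plain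

  relativize : ∀ {k Γ} → Formula sig Rel k Γ → IFm Γ
  relativize (rel r ts)  = rel (old r) ts
  relativize (s ≈ t)     = s ≈ t
  relativize ⊥′          = ⊥′
  relativize (A ∧ B)     = relativize A ∧ relativize B
  relativize (A ⊃ B)     = relativize A ⊃ relativize B
  relativize (∀′ s A)    = ∀′ s (rel (𝓘 s) (v₀ ∷ []) ⊃ relativize A)
  relativize (∃′ s A)    = ∃′ s (rel (𝓘 s) (v₀ ∷ []) ∧ relativize A)
  relativize (∀◁ s B A)  = ∀′ s (relativize B ⊃ relativize A)
  relativize (∃◁ s B A)  = ∃′ s (relativize B ∧ relativize A)

  -- 𝓘(t₁) ∧ … ∧ 𝓘(tₙ), the empty conjunction being ⊤.
  𝓘* : ∀ {Γ Θ} → All Sort Θ → Tms sig Γ Θ → IFm Γ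
  𝓘* []       []       = ⊤′
  𝓘* (s ∷ ss) (t ∷ ts) = rel (𝓘 s) (t ∷ []) ∧ 𝓘* ss ts

  -- ∀x (𝓘(x) → A(x)), where x is the tuple of all variables in the context.
  ∀𝓘 : ∀ {Γ} → All Sort Γ → IFm Γ → IFm []
  ∀𝓘 ss A = close ss (𝓘* ss ids ⊃ A)

record TargetLanguage {Base : Set} (𝓢 : SourceTheory Base) : Set₁ where
  private module 𝓢 = SourceTheory 𝓢
  field
    Wit      : Type Base → Set
    wit-nat  : Wit nat
    wit-⇒    : ∀ {ρ τ} → Wit ρ → Wit τ → Wit (ρ ⇒ τ)
    wit-*    : ∀ {ρ} → Wit ρ → Wit (ρ *)
    Extra    : Type Base → Set
    Rel      : List (Type Base) → Set

  data TExtra : Type Base → Set where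
    source : ∀ {σ} → 𝓢.Extra σ → TExtra σ
    single : ∀ {ρ} → .(Wit ρ) → TExtra (ρ ⇒ ρ *)
    union  : ∀ {ρ} → .(Wit ρ) → TExtra (ρ * ⇒ ρ * ⇒ ρ *)
    -- iunion A f is ⋃ { f x ∣ x ∈ A }
    iunion : ∀ {ρ τ} → .(Wit ρ) → .(Wit τ) → TExtra (ρ * ⇒ (ρ ⇒ τ *) ⇒ τ *)
    max    : TExtra (nat * ⇒ nat)
    other  : ∀ {σ} → Extra σ → TExtra σ

  data TRel : List (Type Base) → Set where
    mem   : ∀ {ρ} → .(Wit ρ) → TRel (ρ ∷ ρ * ∷ [])
    other : ∀ {Θ} → Rel Θ → TRel Θ

  tsig : TermSig Base
  tsig = record
    { Sort = λ _ → ⊤ ; sort-nat = tt ; sort-bool = tt ; sort-⇒ = λ _ _ → tt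
    ; Extra = TExtra }

  TTm : List (Type Base) → Type Base → Set
  TTm = Term tsig

  TTms : List (Type Base) → List (Type Base) → Set
  TTms = Tms tsig

  TFm : List (Type Base) → Set
  TFm = Formula tsig TRel plain

  embedᶜ : ∀ {σ} → Const 𝓢.sig σ → Const tsig σ
  embedᶜ (K _ _)   = K tt tt
  embedᶜ (S _ _ _) = S tt tt tt
  embedᶜ zero      = zero
  embedᶜ suc       = suc
  embedᶜ (rec _)   = rec tt
  embedᶜ true      = true
  embedᶜ false     = false
  embedᶜ (cond _)  = cond tt
  embedᶜ (extra c) = extra (source c)

  embed : ∀ {Γ σ} → Term 𝓢.sig Γ σ → TTm Γ σ
  embed (var i) = var i
  embed (con c) = con (embedᶜ c)
  embed (s · t) = embed s · embed t

  mem′ : ∀ {Γ ρ} → .(Wit ρ) → TTm Γ ρ → TTm Γ (ρ *) → TFm Γ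
  mem′ w x A = rel (mem w) (x ∷ A ∷ [])

  single′ : ∀ {Γ ρ} → .(Wit ρ) → TTm Γ ρ → TTm Γ (ρ *)
  single′ w x = con (extra (single w)) · x

  union′ : ∀ {Γ ρ} → .(Wit ρ) → TTm Γ (ρ *) → TTm Γ (ρ *) → TTm Γ (ρ *)
  union′ w A B = con (extra (union w)) · A · B

  max′ : ∀ {Γ} → TTm Γ (nat *) → TTm Γ nat
  max′ A = con (extra max) · A

  ∀∀ : ∀ {Γ} Θ → TFm (Θ ++ Γ) → TFm Γ
  ∀∀ []      A = A
  ∀∀ (ρ ∷ Θ) A = ∀∀ Θ (∀′ tt A)

  -- ∀b∈B A for tuples, i.e. ∀bₙ(bₙ ∈ Bₙ → … ∀b₁(b₁ ∈ B₁ → A)…).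
  ∀∈ : ∀ {Γ Θ} → All Wit Θ → TTms Γ (map _* Θ) → TFm (Θ ++ Γ) → TFm Γ
  ∀∈ []                   []       A = A
  ∀∈ {Θ = ρ ∷ Θ} (w ∷ ws) (B ∷ Bs) A =
    ∀∈ ws Bs (∀′ tt (mem′ w v₀ (subᵗ (wks (ρ ∷ Θ)) B) ⊃ A))

record TargetTheory {Base : Set} (𝓢 : SourceTheory Base) : Set₁ where
  field
    lang  : TargetLanguage 𝓢
  open TargetLanguage lang public
  field
    -- Every witnessing type is inhabited by a closed term, as is automatic
    -- for the types generated from ℕ by ⇒ and *.
    inhabitant : ∀ {ρ} → Wit ρ → TTm [] ρ
    Axiom      : TFm [] → Set

  infix 10 _∣_⊢_

  -- T ⊢ φ, in context: Γ ∣ Φ ⊢ φ means that T proves φ from the assumptions Φ,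
  -- where the free variables are among Γ.  The logic is intuitionistic;
  -- classical target theories have excluded middle among their axioms.
  data _∣_⊢_ (Γ : List (Type Base)) (Φ : List (TFm Γ)) : TFm Γ → Set where
    axiom : ∀ {A} → Axiom A → Γ ∣ Φ ⊢ sub [] A

    hyp : ∀ {A} → A ∈ Φ → Γ ∣ Φ ⊢ A
    ⊥-E : ∀ {A} → Γ ∣ Φ ⊢ ⊥′ → Γ ∣ Φ ⊢ A
    ∧-I : ∀ {A B} → Γ ∣ Φ ⊢ A → Γ ∣ Φ ⊢ B → Γ ∣ Φ ⊢ A ∧ B
    ∧-Eˡ : ∀ {A B} → Γ ∣ Φ ⊢ A ∧ B → Γ ∣ Φ ⊢ A
    ∧-Eʳ : ∀ {A B} → Γ ∣ Φ ⊢ A ∧ B → Γ ∣ Φ ⊢ B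
    ⊃-I : ∀ {A B} → Γ ∣ A ∷ Φ ⊢ B → Γ ∣ Φ ⊢ A ⊃ B
    ⊃-E : ∀ {A B} → Γ ∣ Φ ⊢ A ⊃ B → Γ ∣ Φ ⊢ A → Γ ∣ Φ ⊢ B
    ∀-I : ∀ {σ} {A : TFm (σ ∷ Γ)} → (σ ∷ Γ) ∣ map wk Φ ⊢ A → Γ ∣ Φ ⊢ ∀′ tt A
    ∀-E : ∀ {σ} {A : TFm (σ ∷ Γ)} → Γ ∣ Φ ⊢ ∀′ tt A → ∀ t → Γ ∣ Φ ⊢ A [ t ]
    ∃-I : ∀ {σ} {A : TFm (σ ∷ Γ)} t → Γ ∣ Φ ⊢ A [ t ] → Γ ∣ Φ ⊢ ∃′ tt A
    ∃-E : ∀ {σ} {A : TFm (σ ∷ Γ)} {B} →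
          Γ ∣ Φ ⊢ ∃′ tt A → (σ ∷ Γ) ∣ A ∷ map wk Φ ⊢ wk B → Γ ∣ Φ ⊢ B

    ≈-refl  : ∀ {σ} {t : TTm Γ σ} → Γ ∣ Φ ⊢ t ≈ t
    ≈-subst : ∀ {σ} (A : TFm (σ ∷ Γ)) {s t} →
              Γ ∣ Φ ⊢ s ≈ t → Γ ∣ Φ ⊢ A [ s ] → Γ ∣ Φ ⊢ A [ t ]

    K-eq : ∀ {σ τ} {s : TTm Γ σ} {t : TTm Γ τ} → Γ ∣ Φ ⊢ con (K tt tt) · s · t ≈ s
    S-eq : ∀ {ρ σ τ} {s : TTm Γ (ρ ⇒ σ ⇒ τ)} {t : TTm Γ (ρ ⇒ σ)} {u : TTm Γ ρ} →
           Γ ∣ Φ ⊢ con (S tt tt tt) · s · t · u ≈ s · u · (t · u)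
    rec-zero : ∀ {σ} {s : TTm Γ σ} {t} → Γ ∣ Φ ⊢ con (rec tt) · s · t · con zero ≈ s
    rec-suc  : ∀ {σ} {s : TTm Γ σ} {t n} →
               Γ ∣ Φ ⊢ con (rec tt) · s · t · (con suc · n)
                         ≈ t · n · (con (rec tt) · s · t · n)

    zero≉   : ∀ {n} → Γ ∣ Φ ⊢ ¬′ (con suc · n ≈ con zero)
    suc-inj : ∀ {m n} → Γ ∣ Φ ⊢ con suc · m ≈ con suc · n → Γ ∣ Φ ⊢ m ≈ n
    nat-ind : {A : TFm (nat ∷ Γ)} → Γ ∣ Φ ⊢ A [ con zero ] →
              Γ ∣ Φ ⊢ ∀′ tt (A ⊃ sub (con suc · v₀ ∷ wk₁) A) → Γ ∣ Φ ⊢ ∀′ tt A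
    ≤-refl  : ∀ {n} → Γ ∣ Φ ⊢ n ≤ n
    ≤-trans : ∀ {m n k} → Γ ∣ Φ ⊢ m ≤ n → Γ ∣ Φ ⊢ n ≤ k → Γ ∣ Φ ⊢ m ≤ k

    single-I  : ∀ {ρ} .{w : Wit ρ} {x} → Γ ∣ Φ ⊢ mem′ w x (single′ w x)
    single-E  : ∀ {ρ} .{w : Wit ρ} {x y} → Γ ∣ Φ ⊢ mem′ w x (single′ w y) → Γ ∣ Φ ⊢ x ≈ y
    union-Iˡ  : ∀ {ρ} .{w : Wit ρ} {x A B} →
                Γ ∣ Φ ⊢ mem′ w x A → Γ ∣ Φ ⊢ mem′ w x (union′ w A B)
    union-Iʳ  : ∀ {ρ} .{w : Wit ρ} {x A B} →
                Γ ∣ Φ ⊢ mem′ w x B → Γ ∣ Φ ⊢ mem′ w x (union′ w A B)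
    union-E   : ∀ {ρ} .{w : Wit ρ} {x A B C} → Γ ∣ Φ ⊢ mem′ w x (union′ w A B) →
                Γ ∣ mem′ w x A ∷ Φ ⊢ C → Γ ∣ mem′ w x B ∷ Φ ⊢ C → Γ ∣ Φ ⊢ C
    iunion-I  : ∀ {ρ τ} .{w : Wit ρ} .{v : Wit τ} {x y A f} →
                Γ ∣ Φ ⊢ mem′ w x A → Γ ∣ Φ ⊢ mem′ v y (f · x) →
                Γ ∣ Φ ⊢ mem′ v y (con (extra (iunion w v)) · A · f)
    iunion-E  : ∀ {ρ τ} .{w : Wit ρ} .{v : Wit τ} {y A f} →
                Γ ∣ Φ ⊢ mem′ v y (con (extra (iunion w v)) · A · f) →
                Γ ∣ Φ ⊢ ∃′ tt (mem′ w v₀ (subᵗ wk₁ A) ∧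
                               mem′ v (subᵗ wk₁ y) (subᵗ wk₁ f · v₀))
    set-ext   : ∀ {ρ} .{w : Wit ρ} {A B : TTm Γ (ρ *)} →
                Γ ∣ Φ ⊢ ∀′ tt (mem′ w v₀ (subᵗ wk₁ A) ⇔′ mem′ w v₀ (subᵗ wk₁ B)) →
                Γ ∣ Φ ⊢ A ≈ B
    -- Every set is obtained from a singleton by adjoining elements.
    set-ind   : ∀ {ρ} .{w : Wit ρ} {A : TFm (ρ * ∷ Γ)} →
                Γ ∣ Φ ⊢ ∀′ tt (sub (single′ w v₀ ∷ wk₁) A) →
                Γ ∣ Φ ⊢ ∀′ tt (∀′ tt (sub (v₁ ∷ wks (ρ ∷ ρ * ∷ [])) A ⊃
                           sub (union′ w v₁ (single′ w v₀) ∷ wks (ρ ∷ ρ * ∷ [])) A)) →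
                Γ ∣ Φ ⊢ ∀′ tt A
    max-upper : ∀ {n A} → Γ ∣ Φ ⊢ mem′ wit-nat n A → Γ ∣ Φ ⊢ n ≤ max′ A
    max-mem   : ∀ {A} → Γ ∣ Φ ⊢ mem′ wit-nat (max′ A) A

module _ {Base : Set} {𝓢 : SourceTheory Base} (𝓣 : TargetTheory 𝓢) where
  open SourceTheory 𝓢 using (IFm; Rel𝓘; 𝓘; sort-nat)
  open TargetTheory 𝓣

  -- ⟨A⟩ᵃ_b for a formula (or relation symbol) A with free variables Γ: the types
  -- of the tuples a and b, and a target formula in the variables a, b, Γ.
  record Interp (Γ : List (Type Base)) : Set where
    constructor interp
    field
      {pos}   : List (Type Base)
      {neg}   : List (Type Base)
      pos-wit : All Wit pos
      neg-wit : All Wit neg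
      body    : TFm (pos ++ neg ++ Γ)

    ⟨_,_,_⟩ : ∀ {Δ} → TTms Δ pos → TTms Δ neg → TTms Δ Γ → TFm Δ
    ⟨ a , b , γ ⟩ = sub (++⁺ a (++⁺ b γ)) body
  open Interp

  wit-⇒* : ∀ {ρs τ} → All Wit ρs → Wit τ → Wit (ρs ⇒* τ)
  wit-⇒* []       v = v
  wit-⇒* (w ∷ ws) v = wit-⇒ w (wit-⇒* ws v)

  -- The three blocks of variables of the context Θ₁ ++ Θ₂ ++ Γ.
  fstᵛ : ∀ Θ₁ Θ₂ {Γ} → TTms (Θ₁ ++ Θ₂ ++ Γ) Θ₁
  fstᵛ Θ₁ Θ₂ = ++⁻ˡ Θ₁ ids

  sndᵛ : ∀ Θ₁ Θ₂ {Γ} → TTms (Θ₁ ++ Θ₂ ++ Γ) Θ₂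
  sndᵛ Θ₁ Θ₂ = ++⁻ˡ Θ₂ (++⁻ʳ Θ₁ ids)

  trdᵛ : ∀ Θ₁ Θ₂ {Γ} → TTms (Θ₁ ++ Θ₂ ++ Γ) Γ
  trdᵛ Θ₁ Θ₂ = ++⁻ʳ Θ₂ (++⁻ʳ Θ₁ ids)

  subᵢ : ∀ {Γ Δ} → TTms Δ Γ → Interp Γ → Interp Δ
  subᵢ γ X = interp (pos-wit X) (neg-wit X)
    (⟨_,_,_⟩ X (fstᵛ (pos X) (neg X)) (sndᵛ (pos X) (neg X))
               (subˢ (trdᵛ (pos X) (neg X)) γ))

  infixr 14 _∧ᵢ_
  infixr 13 _⊃ᵢ_

  ⊥ᵢ : ∀ {Γ} → Interp Γ
  ⊥ᵢ = interp [] [] ⊥′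

  _≈ᵢ_ : ∀ {Γ σ} → TTm Γ σ → TTm Γ σ → Interp Γ
  s ≈ᵢ t = interp [] [] (s ≈ t)

  _∧ᵢ_ : ∀ {Γ} → Interp Γ → Interp Γ → Interp Γ
  _∧ᵢ_ {Γ} X Y = interp (++⁺ (pos-wit X) (pos-wit Y)) (++⁺ (neg-wit X) (neg-wit Y))
    (⟨_,_,_⟩ X (++⁻ˡ (pos X) ac) (++⁻ˡ (neg X) bd) γ ∧
     ⟨_,_,_⟩ Y (++⁻ʳ (pos X) ac) (++⁻ʳ (neg X) bd) γ)
    where
    P N : List (Type Base)
    P = pos X ++ pos Y
    N = neg X ++ neg Y
    ac : TTms (P ++ N ++ Γ) P
    ac = fstᵛ P N
    bd : TTms (P ++ N ++ Γ) N
    bd = sndᵛ P N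
    γ : TTms (P ++ N ++ Γ) Γ
    γ = trdᵛ P N

  _⊃ᵢ_ : ∀ {Γ} → Interp Γ → Interp Γ → Interp Γ
  _⊃ᵢ_ {Γ} X Y = interp
    (++⁺ (map⁺ (All.map (wit-⇒* (pos-wit X)) (pos-wit Y)))
         (map⁺ (All.map (λ w → wit-⇒* (pos-wit X) (wit-⇒* (neg-wit Y) (wit-* w)))
                        (neg-wit X))))
    (++⁺ (pos-wit X) (neg-wit Y))
    (∀∈ (neg-wit X) gad (⟨_,_,_⟩ X (subˢ w a) (++⁻ˡ (neg X) ids) (subˢ w γ)) ⊃
     ⟨_,_,_⟩ Y fa d γ)
    where
    F G P N Θ : List (Type Base)
    F = map (pos X ⇒*_) (pos Y)
    G = map (λ ρ → pos X ⇒* (neg Y ⇒* (ρ *))) (neg X)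
    P = F ++ G
    N = pos X ++ neg Y
    Θ = P ++ N ++ Γ
    f : TTms Θ F
    f = ++⁻ˡ F (fstᵛ P N)
    g : TTms Θ G
    g = ++⁻ʳ F (fstᵛ P N)
    a : TTms Θ (pos X)
    a = ++⁻ˡ (pos X) (sndᵛ P N)
    d : TTms Θ (neg Y)
    d = ++⁻ʳ (pos X) (sndᵛ P N)
    γ : TTms Θ Γ
    γ = trdᵛ P N
    fa : TTms Θ (pos Y)
    fa = All.map (λ h → app₁ (pos X) h a) (map⁻ f)
    gad : TTms Θ (map _* (neg X))
    gad = app (neg Y) (app (pos X) g a) d
    w : TTms (neg X ++ Θ) Θ
    w = wks (neg X)

  ∀ᵢ : ∀ {Γ σ} → Interp (σ ∷ Γ) → Interp Γ
  ∀ᵢ {Γ} {σ} X = interp (pos-wit X) (neg-wit X)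
    (∀′ {σ = σ} tt (⟨_,_,_⟩ X (subˢ wk₁ (fstᵛ (pos X) (neg X)))
                              (subˢ wk₁ (sndᵛ (pos X) (neg X)))
                              (lift (trdᵛ (pos X) (neg X)))))

  ∃ᵢ : ∀ {Γ σ} → Interp (σ ∷ Γ) → Interp Γ
  ∃ᵢ {Γ} {σ} X = interp (pos-wit X) (map⁺ (All.map wit-* (neg-wit X)))
    (∃′ {σ = σ} tt (∀∈ (neg-wit X) (subˢ wk₁ B)
      (⟨_,_,_⟩ X (subˢ w (subˢ wk₁ a)) (++⁻ˡ (neg X) ids) (subˢ w (lift γ)))))
    where
    N Θ : List (Type Base)
    N = map _* (neg X)
    Θ = pos X ++ N ++ Γ
    a : TTms Θ (pos X)
    a = fstᵛ (pos X) N
    B : TTms Θ N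
    B = sndᵛ (pos X) N
    γ : TTms Θ Γ
    γ = trdᵛ (pos X) N
    w : TTms (neg X ++ σ ∷ Θ) (σ ∷ Θ)
    w = wks (neg X)

  BaseInterpretation : Set
  BaseInterpretation = ∀ {Θ} → Rel𝓘 Θ → Interp Θ

  -- ⟨𝓘_ℕ(x)⟩ᵐ is x ≤ m; the variables of the body are m, x in this order.
  bounding : Wit nat → Interp (nat ∷ [])
  bounding w = interp {pos = nat ∷ []} (w ∷ []) [] (v₁ ≤ v₀)

  UsesBounding : BaseInterpretation → Set
  UsesBounding β = Σ (Wit nat) λ w → β (𝓘 sort-nat) ≡ bounding w

  module _ (β : BaseInterpretation) where

    𝒰⟦_⟧ : ∀ {Γ} → IFm Γ → Interp Γ
    𝒰⟦ rel r ts ⟧ = subᵢ (All.map embed ts) (β r)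
    𝒰⟦ s ≈ t ⟧    = embed s ≈ᵢ embed t
    𝒰⟦ ⊥′ ⟧       = ⊥ᵢ
    𝒰⟦ A ∧ B ⟧    = 𝒰⟦ A ⟧ ∧ᵢ 𝒰⟦ B ⟧
    𝒰⟦ A ⊃ B ⟧    = 𝒰⟦ A ⟧ ⊃ᵢ 𝒰⟦ B ⟧
    𝒰⟦ ∀′ _ A ⟧   = ∀ᵢ 𝒰⟦ A ⟧
    𝒰⟦ ∃′ _ A ⟧   = ∃ᵢ 𝒰⟦ A ⟧

    𝒰-Interpretable : ∀ {Γ} → IFm Γ → Set
    𝒰-Interpretable {Γ} A = Σ (TTms [] (pos X)) λ t →
        Γ ∣ [] ⊢ ∀∀ (neg X) (⟨_,_,_⟩ X (subˢ [] t) (++⁻ˡ (neg X) ids) (wks (neg X)))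
      where
      X : Interp Γ
      X = 𝒰⟦ A ⟧

    open SourceTheory 𝓢 using (SFm; Sort; relativize; ∀𝓘)

    -- Here all free variables of A are among Γ.
    𝓘-Interpretable : ∀ {Γ} → All Sort Γ → SFm Γ → Set
    𝓘-Interpretable ss A = 𝒰-Interpretable (∀𝓘 ss (relativize A))

    NoPositive𝓘Witnesses : ∀ {Γ} → SFm Γ → Set
    NoPositive𝓘Witnesses A = pos 𝒰⟦ relativize A ⟧ ≡ []

    Subsumes𝓘 : ∀ {Γ σ} → All Sort Γ → Sort σ → SFm (σ ∷ Γ) → Set
    Subsumes𝓘 ss s B =
      𝒰-Interpretable (∀𝓘 ss (∀′ s (relativize B ⊃ rel (𝓘 s) (v₀ ∷ []))))

    SemiUniform : ∀ {Γ σ} → All Sort Γ → Sort σ → SFm (σ ∷ Γ) → Set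
    SemiUniform ss s B = Subsumes𝓘 ss s B × NoPositive𝓘Witnesses B

module _ {Base : Set} (𝓢 : SourceTheory Base) where
  open SourceTheory 𝓢

  ∀≤ : ∀ {Γ} → Term sig Γ nat → SFm (nat ∷ Γ) → SFm Γ
  ∀≤ k A = ∀◁ sort-nat (v₀ ≤ subᵗ wk₁ k) A

  -- ∀k ∃x◁B ∀n≤k C(x,n) → ∃x◁B ∀n C(x,n); the substitutions on the left
  -- weaken B and C by the variable k.
  boundedCollection : ∀ {Γ σ} → Sort σ → SFm (σ ∷ Γ) → SFm (nat ∷ σ ∷ Γ) → SFm Γ
  boundedCollection s B C =
    ∀′ sort-nat (∃◁ s (sub (lift wk₁) B) (∀≤ v₁ (sub (lift (lift wk₁)) C)))
    ⊃ ∃◁ s B (∀′ sort-nat C)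

{-# OPTIONS --safe #-}
module Submission where

-- The conclusion asks for one x that works against finite sets D, M and E of
-- negative witnesses of B, of bounds for n, and of negative witnesses of C.
-- As B and C have no positive 𝓘-witnesses, realizing the implication only
-- takes finite sets of instances of the premise, and the singletons {max M},
-- {D} and {E} suffice: the x which the premise provides for k = max M satisfies
-- C(x , n) for all n ≤ max M, hence for every n bounded by an element of M.

open import Data.List.Base using (List; []; _∷_; _++_; map)
open import Data.List.Membership.Propositional using (_∈_)
open import Data.List.Membership.Propositional.Properties using (∈-map⁺)
open import Data.List.Relation.Unary.All as All using (All; []; _∷_)
open import Data.List.Relation.Unary.All.Properties
  using (++⁺; ++⁻ˡ; ++⁻ʳ; map⁺; map⁻; map-cong; map-id; map-∘; lookup-map)
open import Data.List.Relation.Unary.Any using (here; there)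
open import Data.Product.Base using (Σ; _,_)
open import Data.Unit.Base using (tt)
open import Function.Base using (_∘_)
open import Relation.Binary.PropositionalEquality
  using (_≡_; refl; sym; trans; cong; cong₂; subst; subst₂; module ≡-Reasoning)
open import Defs

-- Both `M` and the need to bound k come from relativization. A plain quantifier over ℕ acquires the
-- guard 𝓘(n), and the positive witness of 𝓘(n), a number m with n ≤ m, becomes a negative witness
-- of the guarded implication. In the conclusion ∃x gathers these m into `M`. In the premise one
-- such bound must be supplied along with k, and max M serves both as k and as its own bound. The
-- quantifier ∀n≤k has no guard 𝓘 and adds no bound. Neither 𝓘(n) nor n ≤ k has negative witnesses,
-- so implications from them require no positive witnesses beyond those of `C`. The obstacle is
-- syntactic. Interpretations are formulas over blocks of witness variables, `B` and `C` occur in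
-- the premise weakened by k, and realizers must be closed combinator terms. This calls for
-- evaluating each clause under arbitrary substitutions, for commuting the interpretation with
-- substitution, and for bracket abstraction whose β-equations hold only provably in T.

-- Tuples: blocks, concatenation and maps

module _ {A : Set} {P : A → Set} where

  ++⁻ˡ-++⁺ : ∀ {xs ys} (ps : All P xs) (qs : All P ys) → ++⁻ˡ xs (++⁺ ps qs) ≡ ps
  ++⁻ˡ-++⁺ []       qs = refl
  ++⁻ˡ-++⁺ (p ∷ ps) qs = cong (p ∷_) (++⁻ˡ-++⁺ ps qs)

  ++⁻ʳ-++⁺ : ∀ {xs ys} (ps : All P xs) (qs : All P ys) → ++⁻ʳ xs (++⁺ ps qs) ≡ qs
  ++⁻ʳ-++⁺ []       qs = refl
  ++⁻ʳ-++⁺ (p ∷ ps) qs = ++⁻ʳ-++⁺ ps qs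

  ++⁺-++⁻ : ∀ xs {ys} (ps : All P (xs ++ ys)) → ++⁺ (++⁻ˡ xs ps) (++⁻ʳ xs ps) ≡ ps
  ++⁺-++⁻ []       ps       = refl
  ++⁺-++⁻ (x ∷ xs) (p ∷ ps) = cong (p ∷_) (++⁺-++⁻ xs ps)

  tabulate-lookup : ∀ {xs} (ps : All P xs) → All.tabulate (All.lookup ps) ≡ ps
  tabulate-lookup []       = refl
  tabulate-lookup (p ∷ ps) = cong (p ∷_) (tabulate-lookup ps)

  lookup-tabulate : ∀ {xs} (f : ∀ {x} → x ∈ xs → P x) {x} (i : x ∈ xs) →
                    All.lookup (All.tabulate f) i ≡ f i
  lookup-tabulate f (here refl) = refl
  lookup-tabulate f (there i)   = lookup-tabulate (f ∘ there) i

  map⁺-map⁻ : ∀ {B : Set} {f : B → A} {xs} (ps : All P (map f xs)) → map⁺ {P = P} (map⁻ ps) ≡ ps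
  map⁺-map⁻ {xs = []}     []       = refl
  map⁺-map⁻ {xs = x ∷ xs} (p ∷ ps) = cong (p ∷_) (map⁺-map⁻ ps)

module _ {A : Set} {P Q : A → Set} (h : ∀ {x} → P x → Q x) where

  map-++⁺ : ∀ {xs ys} (ps : All P xs) (qs : All P ys) →
            All.map h (++⁺ ps qs) ≡ ++⁺ (All.map h ps) (All.map h qs)
  map-++⁺ []       qs = refl
  map-++⁺ (p ∷ ps) qs = cong (h p ∷_) (map-++⁺ ps qs)

  map-++⁻ˡ : ∀ xs {ys} (ps : All P (xs ++ ys)) →
             All.map h (++⁻ˡ xs ps) ≡ ++⁻ˡ xs (All.map h ps)
  map-++⁻ˡ []       ps       = refl
  map-++⁻ˡ (x ∷ xs) (p ∷ ps) = cong (h p ∷_) (map-++⁻ˡ xs ps)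

  map-++⁻ʳ : ∀ xs {ys} (ps : All P (xs ++ ys)) →
             All.map h (++⁻ʳ xs ps) ≡ ++⁻ʳ xs (All.map h ps)
  map-++⁻ʳ []       ps       = refl
  map-++⁻ʳ (x ∷ xs) (p ∷ ps) = map-++⁻ʳ xs ps

  map-map⁺ : ∀ {B : Set} {f : B → A} {xs} (ps : All (P ∘ f) xs) →
             All.map h (map⁺ {P = P} ps) ≡ map⁺ {P = Q} {f = f} (All.map h ps)
  map-map⁺ []       = refl
  map-map⁺ (p ∷ ps) = cong (h p ∷_) (map-map⁺ ps)

  map-map⁻ : ∀ {B : Set} {f : B → A} {xs} (ps : All P (map f xs)) →
             All.map h (map⁻ {P = P} {f = f} ps) ≡ map⁻ {P = Q} (All.map h ps)
  map-map⁻ {xs = []}     []       = refl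
  map-map⁻ {xs = x ∷ xs} (p ∷ ps) = cong (h p ∷_) (map-map⁻ ps)

  map-tabulate : ∀ {xs} (f : ∀ {x} → x ∈ xs → P x) →
                 All.map h (All.tabulate f) ≡ All.tabulate (λ {x} i → h (f {x} i))
  map-tabulate {[]}     f = refl
  map-tabulate {x ∷ xs} f = cong (h (f (here refl)) ∷_) (map-tabulate (f ∘ there))

-- Substitution

module _ {Base : Set} {L : TermSig Base} where

  private
    variable
      Γ Δ Ξ Θ Θ₁ Θ₂ : List (Type Base)
      σ τ : Type Base

  subᵗ-subᵗ : (γ : Tms L Ξ Δ) (δ : Tms L Δ Γ) (t : Term L Γ τ) →
              subᵗ γ (subᵗ δ t) ≡ subᵗ (subˢ γ δ) t
  subᵗ-subᵗ γ δ (var i) = sym (lookup-map δ i)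
  subᵗ-subᵗ γ δ (con c) = refl
  subᵗ-subᵗ γ δ (s · t) = cong₂ _·_ (subᵗ-subᵗ γ δ s) (subᵗ-subᵗ γ δ t)

  subᵗ-ids : (t : Term L Γ τ) → subᵗ ids t ≡ t
  subᵗ-ids (var i) = lookup-tabulate var i
  subᵗ-ids (con c) = refl
  subᵗ-ids (s · t) = cong₂ _·_ (subᵗ-ids s) (subᵗ-ids t)

  subˢ-subˢ : (γ : Tms L Ξ Δ) (δ : Tms L Δ Γ) (ts : Tms L Γ Θ) →
              subˢ γ (subˢ δ ts) ≡ subˢ (subˢ γ δ) ts
  subˢ-subˢ γ δ ts = trans (map-∘ ts) (map-cong ts (subᵗ-subᵗ γ δ))

  subˢ-idˡ : (ts : Tms L Γ Θ) → subˢ ids ts ≡ ts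
  subˢ-idˡ ts = trans (map-cong ts subᵗ-ids) (map-id ts)

  subˢ-idʳ : (γ : Tms L Δ Γ) → subˢ γ ids ≡ γ
  subˢ-idʳ γ = trans (map-tabulate (subᵗ γ) var) (tabulate-lookup γ)

  subˢ-wks : (ts : Tms L Δ Θ) (γ : Tms L Δ Γ) → subˢ (++⁺ ts γ) (wks Θ) ≡ γ
  subˢ-wks {Θ = Θ} ts γ = begin
    subˢ (++⁺ ts γ) (++⁻ʳ Θ ids)  ≡⟨ map-++⁻ʳ (subᵗ (++⁺ ts γ)) Θ ids ⟩
    ++⁻ʳ Θ (subˢ (++⁺ ts γ) ids)  ≡⟨ cong (++⁻ʳ Θ) (subˢ-idʳ (++⁺ ts γ)) ⟩
    ++⁻ʳ Θ (++⁺ ts γ)             ≡⟨ ++⁻ʳ-++⁺ ts γ ⟩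
    γ                             ∎
    where open ≡-Reasoning

  subˢ-fst : (ts : Tms L Δ Θ) (γ : Tms L Δ Γ) → subˢ (++⁺ ts γ) (++⁻ˡ Θ ids) ≡ ts
  subˢ-fst {Θ = Θ} ts γ = begin
    subˢ (++⁺ ts γ) (++⁻ˡ Θ ids)  ≡⟨ map-++⁻ˡ (subᵗ (++⁺ ts γ)) Θ ids ⟩
    ++⁻ˡ Θ (subˢ (++⁺ ts γ) ids)  ≡⟨ cong (++⁻ˡ Θ) (subˢ-idʳ (++⁺ ts γ)) ⟩
    ++⁻ˡ Θ (++⁺ ts γ)             ≡⟨ ++⁻ˡ-++⁺ ts γ ⟩
    ts                            ∎
    where open ≡-Reasoning

  subˢ-wk₁ : (t : Term L Δ σ) (γ : Tms L Δ Γ) → subˢ (t ∷ γ) wk₁ ≡ γ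
  subˢ-wk₁ t γ = subˢ-wks (t ∷ []) γ

  subˢ-subˢ-wk₁ : (t : Term L Δ σ) (γ : Tms L Δ Γ) (ts : Tms L Γ Θ) →
                  subˢ (t ∷ γ) (subˢ wk₁ ts) ≡ subˢ γ ts
  subˢ-subˢ-wk₁ t γ ts =
    trans (subˢ-subˢ (t ∷ γ) wk₁ ts) (cong (λ δ → subˢ δ ts) (subˢ-wk₁ t γ))

  subˢ-subˢ-wks : (ts : Tms L Δ Θ₁) (γ : Tms L Δ Γ) (us : Tms L Γ Θ₂) →
                  subˢ (++⁺ ts γ) (subˢ (wks Θ₁) us) ≡ subˢ γ us
  subˢ-subˢ-wks {Θ₁ = Θ₁} ts γ us =
    trans (subˢ-subˢ (++⁺ ts γ) (wks Θ₁) us) (cong (λ δ → subˢ δ us) (subˢ-wks ts γ))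

  subˢ-lift : (t : Term L Ξ σ) (γ : Tms L Ξ Δ) (δ : Tms L Δ Γ) →
              subˢ (t ∷ γ) (lift δ) ≡ t ∷ subˢ γ δ
  subˢ-lift t γ δ = cong (t ∷_) (subˢ-subˢ-wk₁ t γ δ)

  lift-subˢ : (γ : Tms L Ξ Δ) (δ : Tms L Δ Γ) →
              subˢ (lift {σ = σ} γ) (lift δ) ≡ lift (subˢ γ δ)
  lift-subˢ γ δ =
    trans (subˢ-lift v₀ (subˢ wk₁ γ) δ) (cong (v₀ ∷_) (sym (subˢ-subˢ wk₁ γ δ)))

  lift-ids : lift {Γ = Γ} {σ = σ} ids ≡ ids {L = L}
  lift-ids = cong (v₀ ∷_) (subˢ-idʳ wk₁)

  -- A concatenation of blocks rather than an iterated `lift`, so that `subˢ-fst` and `subˢ-wks`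
  -- evaluate it at once; `lift-lifts` gives the recursive step needed under a binder.
  lifts : ∀ Θ → Tms L Δ Γ → Tms L (Θ ++ Δ) (Θ ++ Γ)
  lifts Θ γ = ++⁺ (++⁻ˡ Θ ids) (subˢ (wks Θ) γ)

  wks-∷ : ∀ Θ → wks {L = L} {Γ = Γ} (σ ∷ Θ) ≡ subˢ wk₁ (wks Θ)
  wks-∷ Θ = sym (trans (map-++⁻ʳ (subᵗ wk₁) Θ ids) (cong (++⁻ʳ Θ) (subˢ-idʳ wk₁)))

  lift-lifts : ∀ Θ (γ : Tms L Δ Γ) → lift {σ = σ} (lifts Θ γ) ≡ lifts (σ ∷ Θ) γ
  lift-lifts Θ γ = cong (v₀ ∷_) (trans (map-++⁺ (subᵗ wk₁) (++⁻ˡ Θ ids) (subˢ (wks Θ) γ))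
    (cong₂ ++⁺
      (trans (map-++⁻ˡ (subᵗ wk₁) Θ ids) (cong (++⁻ˡ Θ) (subˢ-idʳ wk₁)))
      (trans (subˢ-subˢ wk₁ (wks Θ) γ) (cong (λ δ → subˢ δ γ) (sym (wks-∷ Θ))))))

  subᵗ-app₁ : ∀ ρs (γ : Tms L Δ Γ) (f : Term L Γ (ρs ⇒* τ)) as →
              subᵗ γ (app₁ ρs f as) ≡ app₁ ρs (subᵗ γ f) (subˢ γ as)
  subᵗ-app₁ []       γ f []       = refl
  subᵗ-app₁ (ρ ∷ ρs) γ f (a ∷ as) = subᵗ-app₁ ρs γ (f · a) as

  subˢ-app : ∀ ρs {A : Set} {u : A → Type Base} {xs} (γ : Tms L Δ Γ)
             (fs : Tms L Γ (map (λ x → ρs ⇒* u x) xs)) as →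
             subˢ γ (app ρs {u = u} fs as) ≡ app ρs {u = u} (subˢ γ fs) (subˢ γ as)
  subˢ-app ρs {xs = []}     γ []       as = refl
  subˢ-app ρs {xs = x ∷ xs} γ (f ∷ fs) as =
    cong₂ _∷_ (subᵗ-app₁ ρs γ f as) (subˢ-app ρs γ fs as)

  subˢ-wk₁-⁻¹ : (t : Term L Γ σ) (us : Tms L Γ Θ) → subˢ (t ∷ ids) (subˢ wk₁ us) ≡ us
  subˢ-wk₁-⁻¹ t us = trans (subˢ-subˢ-wk₁ t ids us) (subˢ-idˡ us)

module _ {Base : Set} {L : TermSig Base} {R : List (Type Base) → Set} where

  private
    variable
      Γ Δ Ξ : List (Type Base)
      σ : Type Base
      k : Kind

  sub-sub : (γ : Tms L Ξ Δ) (δ : Tms L Δ Γ) (A : Formula L R k Γ) →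
            sub γ (sub δ A) ≡ sub (subˢ γ δ) A
  sub-sub-lift : (γ : Tms L Ξ Δ) (δ : Tms L Δ Γ) (A : Formula L R k (σ ∷ Γ)) →
                 sub (lift γ) (sub (lift δ) A) ≡ sub (lift (subˢ γ δ)) A
  sub-sub γ δ (rel r ts) = cong (rel r) (subˢ-subˢ γ δ ts)
  sub-sub γ δ (s ≈ t)    = cong₂ _≈_ (subᵗ-subᵗ γ δ s) (subᵗ-subᵗ γ δ t)
  sub-sub γ δ ⊥′         = refl
  sub-sub γ δ (A ∧ B)    = cong₂ _∧_ (sub-sub γ δ A) (sub-sub γ δ B)
  sub-sub γ δ (A ⊃ B)    = cong₂ _⊃_ (sub-sub γ δ A) (sub-sub γ δ B)
  sub-sub γ δ (∀′ s A)   = cong (∀′ s) (sub-sub-lift γ δ A)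
  sub-sub γ δ (∃′ s A)   = cong (∃′ s) (sub-sub-lift γ δ A)
  sub-sub γ δ (∀◁ s B A) = cong₂ (∀◁ s) (sub-sub-lift γ δ B) (sub-sub-lift γ δ A)
  sub-sub γ δ (∃◁ s B A) = cong₂ (∃◁ s) (sub-sub-lift γ δ B) (sub-sub-lift γ δ A)
  sub-sub-lift γ δ A =
    trans (sub-sub (lift γ) (lift δ) A) (cong (λ ε → sub ε A) (lift-subˢ γ δ))

  sub-ids : (A : Formula L R k Γ) → sub ids A ≡ A
  sub-lift-ids : (A : Formula L R k (σ ∷ Γ)) → sub (lift ids) A ≡ A
  sub-ids (rel r ts) = cong (rel r) (subˢ-idˡ ts)
  sub-ids (s ≈ t)    = cong₂ _≈_ (subᵗ-ids s) (subᵗ-ids t)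
  sub-ids ⊥′         = refl
  sub-ids (A ∧ B)    = cong₂ _∧_ (sub-ids A) (sub-ids B)
  sub-ids (A ⊃ B)    = cong₂ _⊃_ (sub-ids A) (sub-ids B)
  sub-ids (∀′ s A)   = cong (∀′ s) (sub-lift-ids A)
  sub-ids (∃′ s A)   = cong (∃′ s) (sub-lift-ids A)
  sub-ids (∀◁ s B A) = cong₂ (∀◁ s) (sub-lift-ids B) (sub-lift-ids A)
  sub-ids (∃◁ s B A) = cong₂ (∃◁ s) (sub-lift-ids B) (sub-lift-ids A)
  sub-lift-ids A = trans (cong (λ γ → sub γ A) lift-ids) (sub-ids A)

  sub-lift-[] : (t : Term L Δ σ) (γ : Tms L Δ Γ) (A : Formula L R k (σ ∷ Γ)) →
                sub (lift γ) A [ t ] ≡ sub (t ∷ γ) A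
  sub-lift-[] t γ A = trans (sub-sub (t ∷ ids) (lift γ) A)
    (cong (λ δ → sub δ A) (trans (subˢ-lift t ids γ) (cong (t ∷_) (subˢ-idˡ γ))))

-- Deleting one component of a tuple

module _ {A : Set} {P : A → Set} where

  -- Needed for `y` = `nat`: the matrix of the conclusion has one negative witness more than that of
  -- the premise, the bound for n, which sits between the witnesses of `B` and those of `C`.
  remove : ∀ xs {y ys} → All P (xs ++ y ∷ ys) → All P (xs ++ ys)
  remove []       (p ∷ ps) = ps
  remove (x ∷ xs) (p ∷ ps) = p ∷ remove xs ps

  middle : ∀ xs {y ys} → All P (xs ++ y ∷ ys) → P y
  middle []       (p ∷ ps) = p
  middle (x ∷ xs) (p ∷ ps) = middle xs ps

  ++⁻ˡ-remove : ∀ xs {y ys} (ps : All P (xs ++ y ∷ ys)) →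
                ++⁻ˡ xs (remove xs ps) ≡ ++⁻ˡ xs ps
  ++⁻ˡ-remove []       (p ∷ ps) = refl
  ++⁻ˡ-remove (x ∷ xs) (p ∷ ps) = cong (p ∷_) (++⁻ˡ-remove xs ps)

  ++⁻ʳ-remove : ∀ xs {y ys} (ps : All P (xs ++ y ∷ ys)) →
                middle xs ps ∷ ++⁻ʳ xs (remove xs ps) ≡ ++⁻ʳ xs ps
  ++⁻ʳ-remove []       (p ∷ ps) = refl
  ++⁻ʳ-remove (x ∷ xs) (p ∷ ps) = ++⁻ʳ-remove xs ps

module _ {A : Set} {P Q : A → Set} (h : ∀ {x} → P x → Q x) where

  map-remove : ∀ xs {y ys} (ps : All P (xs ++ y ∷ ys)) →
               All.map h (remove xs ps) ≡ remove xs (All.map h ps)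
  map-remove []       (p ∷ ps) = refl
  map-remove (x ∷ xs) (p ∷ ps) = cong (h p ∷_) (map-remove xs ps)

  map-middle : ∀ xs {y ys} (ps : All P (xs ++ y ∷ ys)) →
               h (middle xs ps) ≡ middle xs (All.map h ps)
  map-middle []       (p ∷ ps) = refl
  map-middle (x ∷ xs) (p ∷ ps) = map-middle xs ps

module _ {Base : Set} {L : TermSig Base} where

  subᵗ-wk₁-⁻¹ : ∀ {Γ : List (Type Base)} {σ τ} (t : Term L Γ σ) (u : Term L Γ τ) →
                subᵗ (t ∷ ids) (subᵗ wk₁ u) ≡ u
  subᵗ-wk₁-⁻¹ t u = trans (subᵗ-subᵗ (t ∷ ids) wk₁ u)
    (trans (cong (λ γ → subᵗ γ u) (subˢ-wk₁ t ids)) (subᵗ-ids u))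

-- Relativization, embedding and tuple quantifiers under substitution

module _ {Base : Set} (𝓢 : SourceTheory Base) where
  open SourceTheory 𝓢

  relativize-sub : ∀ {k Γ Δ} (γ : Tms sig Δ Γ) (A : Formula sig Rel k Γ) →
                   relativize (sub γ A) ≡ sub γ (relativize A)
  relativize-sub γ (rel r ts)  = refl
  relativize-sub γ (s ≈ t)     = refl
  relativize-sub γ ⊥′          = refl
  relativize-sub γ (A ∧ B)     = cong₂ _∧_ (relativize-sub γ A) (relativize-sub γ B)
  relativize-sub γ (A ⊃ B)     = cong₂ _⊃_ (relativize-sub γ A) (relativize-sub γ B)
  relativize-sub γ (∀′ s A)    = cong (λ C → ∀′ s (_ ⊃ C)) (relativize-sub (lift γ) A)
  relativize-sub γ (∃′ s A)    = cong (λ C → ∃′ s (_ ∧ C)) (relativize-sub (lift γ) A)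
  relativize-sub γ (∀◁ s B A)  =
    cong₂ (λ C D → ∀′ s (C ⊃ D)) (relativize-sub (lift γ) B) (relativize-sub (lift γ) A)
  relativize-sub γ (∃◁ s B A)  =
    cong₂ (λ C D → ∃′ s (C ∧ D)) (relativize-sub (lift γ) B) (relativize-sub (lift γ) A)

module _ {Base : Set} {𝓢 : SourceTheory Base} (𝓣 : TargetTheory 𝓢) where
  private module 𝓢 = SourceTheory 𝓢
  open TargetTheory 𝓣

  private
    variable
      Γ Δ Ξ Θ : List (Type Base)
      ρ σ τ : Type Base
      Φ : List (TFm Γ)

  embed-subᵗ : (γ : Tms 𝓢.sig Δ Γ) (t : Term 𝓢.sig Γ τ) →
               embed (subᵗ γ t) ≡ subᵗ (All.map embed γ) (embed t)
  embed-subᵗ γ (var i) = sym (lookup-map γ i)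
  embed-subᵗ γ (con c) = refl
  embed-subᵗ γ (s · t) = cong₂ _·_ (embed-subᵗ γ s) (embed-subᵗ γ t)

  embed-subˢ : (γ : Tms 𝓢.sig Δ Γ) (ts : Tms 𝓢.sig Γ Θ) →
               All.map embed (subˢ γ ts) ≡ subˢ (All.map embed γ) (All.map embed ts)
  embed-subˢ γ ts =
    trans (map-∘ ts) (trans (map-cong ts (embed-subᵗ γ)) (sym (map-∘ ts)))

  embed-wk₁ : All.map embed (wk₁ {Γ = Γ} {σ = σ}) ≡ wk₁
  embed-wk₁ = map-tabulate embed (var ∘ there)

  embed-lift : (γ : Tms 𝓢.sig Δ Γ) →
               All.map embed (lift {σ = σ} γ) ≡ lift (All.map embed γ)
  embed-lift γ = cong (v₀ ∷_)
    (trans (embed-subˢ wk₁ γ) (cong (λ δ → subˢ δ (All.map embed γ)) embed-wk₁))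

  sub-∀∈ : (γ : TTms Δ Γ) (ws : All Wit Θ) (Bs : TTms Γ (map _* Θ)) (A : TFm (Θ ++ Γ)) →
           sub γ (∀∈ ws Bs A) ≡ ∀∈ ws (subˢ γ Bs) (sub (lifts Θ γ) A)
  sub-∀∈ γ [] [] A = cong (λ δ → sub δ A) (sym (subˢ-idˡ γ))
  sub-∀∈ {Θ = ρ ∷ Θ} γ (w ∷ ws) (B ∷ Bs) A =
    trans (sub-∀∈ γ ws Bs (∀′ tt (mem′ w v₀ (subᵗ (wks (ρ ∷ Θ)) B) ⊃ A)))
          (cong (λ C → ∀∈ ws (subˢ γ Bs) (∀′ tt C)) (cong₂ _⊃_ (cong (mem′ w v₀) B-eq) A-eq))
    where
    A-eq : sub (lift (lifts Θ γ)) A ≡ sub (lifts (ρ ∷ Θ) γ) A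
    A-eq = cong (λ δ → sub δ A) (lift-lifts Θ γ)
    B-eq : subᵗ (lift (lifts Θ γ)) (subᵗ (wks (ρ ∷ Θ)) B) ≡ subᵗ (wks (ρ ∷ Θ)) (subᵗ γ B)
    B-eq = begin
      subᵗ (lift (lifts Θ γ)) (subᵗ (wks (ρ ∷ Θ)) B)
        ≡⟨ cong (λ δ → subᵗ δ (subᵗ (wks (ρ ∷ Θ)) B)) (lift-lifts Θ γ) ⟩
      subᵗ (lifts (ρ ∷ Θ) γ) (subᵗ (wks (ρ ∷ Θ)) B)
        ≡⟨ subᵗ-subᵗ (lifts (ρ ∷ Θ) γ) (wks (ρ ∷ Θ)) B ⟩
      subᵗ (subˢ (lifts (ρ ∷ Θ) γ) (wks (ρ ∷ Θ))) B
        ≡⟨ cong (λ δ → subᵗ δ B) (subˢ-wks (++⁻ˡ (ρ ∷ Θ) ids) (subˢ (wks (ρ ∷ Θ)) γ)) ⟩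
      subᵗ (subˢ (wks (ρ ∷ Θ)) γ) B
        ≡⟨ subᵗ-subᵗ (wks (ρ ∷ Θ)) γ B ⟨
      subᵗ (wks (ρ ∷ Θ)) (subᵗ γ B) ∎
      where open ≡-Reasoning

  open Interp

  -- Evaluation of the clauses of the interpretation

  opaque

    -- Opaque, so that instances of large interpretations are compared by their arguments and not by
    -- their unfolded bodies; equations such as `⟨∧⟩` and `⟨⊃⟩` open one clause at a time.
    ⟨_⟩ : (X : Interp 𝓣 Γ) → TTms Δ (pos X) → TTms Δ (neg X) → TTms Δ Γ → TFm Δ
    ⟨ X ⟩ a b γ = ⟨_,_,_⟩ X a b γ

    -- This block occurs in the clause for implication and in the one for ∃, which thus share one
    -- substitution lemma.
    ⟨_⟩∈ : (X : Interp 𝓣 Γ) → TTms Δ (pos X) → TTms Δ (map _* (neg X)) → TTms Δ Γ → TFm Δ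
    ⟨ X ⟩∈ a B γ = ∀∈ (neg-wit X) B
      (⟨ X ⟩ (subˢ (wks (neg X)) a) (++⁻ˡ (neg X) ids) (subˢ (wks (neg X)) γ))

  module _ (X : Interp 𝓣 Γ) where

    ⟨⟩-cong : ∀ {a a′ : TTms Δ (pos X)} {b b′ γ γ′} → a ≡ a′ → b ≡ b′ → γ ≡ γ′ →
              ⟨ X ⟩ a b γ ≡ ⟨ X ⟩ a′ b′ γ′
    ⟨⟩-cong refl refl refl = refl

    ⟨⟩∈-cong : ∀ {a a′ : TTms Δ (pos X)} {B B′ γ γ′} → a ≡ a′ → B ≡ B′ → γ ≡ γ′ →
               ⟨ X ⟩∈ a B γ ≡ ⟨ X ⟩∈ a′ B′ γ′
    ⟨⟩∈-cong refl refl refl = refl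

    opaque
      unfolding ⟨_⟩ ⟨_⟩∈

      ⟨⟩-unfold : (a : TTms Δ (pos X)) → ∀ b γ → ⟨_,_,_⟩ X a b γ ≡ ⟨ X ⟩ a b γ
      ⟨⟩-unfold a b γ = refl

      ⟨⟩∈-unfold : (a : TTms Δ (pos X)) → ∀ B γ →
        ∀∈ (neg-wit X) B
           (⟨_,_,_⟩ X (subˢ (wks (neg X)) a) (++⁻ˡ (neg X) ids) (subˢ (wks (neg X)) γ)) ≡
        ⟨ X ⟩∈ a B γ
      ⟨⟩∈-unfold a B γ = refl

      sub-⟨⟩ : (δ : TTms Ξ Δ) → ∀ a b γ →
               sub δ (⟨ X ⟩ a b γ) ≡ ⟨ X ⟩ (subˢ δ a) (subˢ δ b) (subˢ δ γ)
      sub-⟨⟩ δ a b γ = trans (sub-sub δ (++⁺ a (++⁺ b γ)) (body X))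
        (cong (λ ε → sub ε (body X))
          (trans (map-++⁺ (subᵗ δ) a (++⁺ b γ))
                 (cong (++⁺ (subˢ δ a)) (map-++⁺ (subᵗ δ) b γ))))

    ⟨⟩∈-at : (a : TTms Δ (pos X)) → ∀ B γ → ⟨ X ⟩∈ a B γ ≡
             ∀∈ (neg-wit X) B
                (⟨ X ⟩ (subˢ (wks (neg X)) a) (++⁻ˡ (neg X) ids) (subˢ (wks (neg X)) γ))
    ⟨⟩∈-at a B γ = trans (sym (⟨⟩∈-unfold a B γ)) (cong (∀∈ (neg-wit X) B) (⟨⟩-unfold _ _ _))

    sub-⟨⟩∈ : (δ : TTms Ξ Δ) → ∀ a B γ →
              sub δ (⟨ X ⟩∈ a B γ) ≡ ⟨ X ⟩∈ (subˢ δ a) (subˢ δ B) (subˢ δ γ)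
    sub-⟨⟩∈ δ a B γ = begin
      sub δ (⟨ X ⟩∈ a B γ)
        ≡⟨ cong (sub δ) (⟨⟩∈-at a B γ) ⟩
      sub δ (∀∈ (neg-wit X) B (⟨ X ⟩ (subˢ (wks N) a) (++⁻ˡ N ids) (subˢ (wks N) γ)))
        ≡⟨ sub-∀∈ δ (neg-wit X) B _ ⟩
      ∀∈ (neg-wit X) (subˢ δ B)
         (sub (lifts N δ) (⟨ X ⟩ (subˢ (wks N) a) (++⁻ˡ N ids) (subˢ (wks N) γ)))
        ≡⟨ cong (∀∈ (neg-wit X) (subˢ δ B)) (trans (sub-⟨⟩ (lifts N δ) _ _ _)
             (⟨⟩-cong (wks-eq a) (subˢ-fst (++⁻ˡ N ids) (subˢ (wks N) δ)) (wks-eq γ))) ⟩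
      ∀∈ (neg-wit X) (subˢ δ B)
         (⟨ X ⟩ (subˢ (wks N) (subˢ δ a)) (++⁻ˡ N ids) (subˢ (wks N) (subˢ δ γ)))
        ≡⟨ ⟨⟩∈-at (subˢ δ a) (subˢ δ B) (subˢ δ γ) ⟨
      ⟨ X ⟩∈ (subˢ δ a) (subˢ δ B) (subˢ δ γ) ∎
      where
      open ≡-Reasoning
      N : List (Type Base)
      N = neg X
      wks-eq : ∀ {Θ} (ts : TTms _ Θ) →
               subˢ (lifts N δ) (subˢ (wks N) ts) ≡ subˢ (wks N) (subˢ δ ts)
      wks-eq ts = trans (subˢ-subˢ-wks (++⁻ˡ N ids) (subˢ (wks N) δ) ts)
                        (sym (subˢ-subˢ (wks N) δ ts))

  module _ {Θ₁ Θ₂ : List (Type Base)} (a : TTms Δ Θ₁) (b : TTms Δ Θ₂) (γ : TTms Δ Γ) where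

    subˢ-fstᵛ : subˢ (++⁺ a (++⁺ b γ)) (fstᵛ 𝓣 Θ₁ Θ₂) ≡ a
    subˢ-fstᵛ = subˢ-fst a (++⁺ b γ)

    subˢ-sndᵛ : subˢ (++⁺ a (++⁺ b γ)) (sndᵛ 𝓣 Θ₁ Θ₂) ≡ b
    subˢ-sndᵛ = trans (map-++⁻ˡ (subᵗ _) Θ₂ (wks Θ₁))
      (trans (cong (++⁻ˡ Θ₂) (subˢ-wks a (++⁺ b γ))) (++⁻ˡ-++⁺ b γ))

    subˢ-trdᵛ : subˢ (++⁺ a (++⁺ b γ)) (trdᵛ 𝓣 Θ₁ Θ₂) ≡ γ
    subˢ-trdᵛ = trans (map-++⁻ʳ (subᵗ _) Θ₂ (wks Θ₁))
      (trans (cong (++⁻ʳ Θ₂) (subˢ-wks a (++⁺ b γ))) (++⁻ʳ-++⁺ b γ))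

  apps : ∀ ρs {τs} → TTms Δ (map (ρs ⇒*_) τs) → TTms Δ ρs → TTms Δ τs
  apps ρs fs as = All.map (λ h → app₁ ρs h as) (map⁻ fs)

  subˢ-apps : ∀ ρs {τs} (γ : TTms Δ Γ) (fs : TTms Γ (map (ρs ⇒*_) τs)) as →
              subˢ γ (apps ρs fs as) ≡ apps ρs (subˢ γ fs) (subˢ γ as)
  subˢ-apps ρs {[]}     γ []       as = refl
  subˢ-apps ρs {τ ∷ τs} γ (f ∷ fs) as = cong₂ _∷_ (subᵗ-app₁ ρs γ f as) (subˢ-apps ρs γ fs as)

  subˢ-lift-wk₁ : (ε : TTms Δ Γ) (ts : TTms Γ Θ) →
                  subˢ (lift {σ = σ} ε) (subˢ wk₁ ts) ≡ subˢ wk₁ (subˢ ε ts)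
  subˢ-lift-wk₁ ε ts = trans (subˢ-subˢ-wk₁ v₀ (subˢ wk₁ ε) ts) (sym (subˢ-subˢ wk₁ ε ts))

  ⟨⟩-at : (X : Interp 𝓣 Γ) (a : TTms Δ (pos X)) → ∀ b γ →
          ⟨ X ⟩ a b γ ≡ sub (++⁺ a (++⁺ b γ)) (body X)
  ⟨⟩-at X a b γ = sym (⟨⟩-unfold X a b γ)

  sub-⟨,,⟩ : (X : Interp 𝓣 Γ) (ε : TTms Ξ Δ) {a′ : TTms Ξ (pos X)} {b′ : TTms Ξ (neg X)}
             {γ′ : TTms Ξ Γ} → ∀ a b γ → subˢ ε a ≡ a′ → subˢ ε b ≡ b′ → subˢ ε γ ≡ γ′ →
             sub ε (⟨_,_,_⟩ X a b γ) ≡ ⟨ X ⟩ a′ b′ γ′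
  sub-⟨,,⟩ X ε a b γ a-eq b-eq γ-eq = trans (cong (sub ε) (⟨⟩-unfold X a b γ))
    (trans (sub-⟨⟩ X ε a b γ) (⟨⟩-cong X a-eq b-eq γ-eq))

  sub-⟨,,⟩∈ : (X : Interp 𝓣 Γ) (ε : TTms Ξ Δ) {a′ : TTms Ξ (pos X)} {B′ : TTms Ξ (map _* (neg X))}
    {γ′ : TTms Ξ Γ} → ∀ a B γ → subˢ ε a ≡ a′ → subˢ ε B ≡ B′ → subˢ ε γ ≡ γ′ →
    sub ε (∀∈ (neg-wit X) B
            (⟨_,_,_⟩ X (subˢ (wks (neg X)) a) (++⁻ˡ (neg X) ids) (subˢ (wks (neg X)) γ))) ≡
    ⟨ X ⟩∈ a′ B′ γ′
  sub-⟨,,⟩∈ X ε a B γ a-eq B-eq γ-eq = trans (cong (sub ε) (⟨⟩∈-unfold X a B γ))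
    (trans (sub-⟨⟩∈ X ε a B γ) (⟨⟩∈-cong X a-eq B-eq γ-eq))

  ⟨subᵢ⟩ : (δ : TTms Δ Γ) (X : Interp 𝓣 Γ) (a : TTms Ξ (pos X)) → ∀ b γ →
           ⟨ subᵢ 𝓣 δ X ⟩ a b γ ≡ ⟨ X ⟩ a b (subˢ γ δ)
  ⟨subᵢ⟩ δ X a b γ = trans (⟨⟩-at (subᵢ 𝓣 δ X) a b γ)
    (sub-⟨,,⟩ X (++⁺ a (++⁺ b γ))
      (fstᵛ 𝓣 (pos X) (neg X)) (sndᵛ 𝓣 (pos X) (neg X)) (subˢ (trdᵛ 𝓣 (pos X) (neg X)) δ)
      (subˢ-fstᵛ a b γ) (subˢ-sndᵛ a b γ)
      (trans (subˢ-subˢ _ (trdᵛ 𝓣 (pos X) (neg X)) δ)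
             (cong (λ ε → subˢ ε δ) (subˢ-trdᵛ a b γ))))

  ⟨∧⟩ : (X Y : Interp 𝓣 Γ) (ac : TTms Δ (pos X ++ pos Y)) → ∀ bd γ →
        ⟨ _∧ᵢ_ 𝓣 X Y ⟩ ac bd γ ≡
        (⟨ X ⟩ (++⁻ˡ (pos X) ac) (++⁻ˡ (neg X) bd) γ ∧
         ⟨ Y ⟩ (++⁻ʳ (pos X) ac) (++⁻ʳ (neg X) bd) γ)
  ⟨∧⟩ {Γ = Γ} X Y ac bd γ = trans (⟨⟩-at (_∧ᵢ_ 𝓣 X Y) ac bd γ) (cong₂ _∧_
    (sub-⟨,,⟩ X ε (++⁻ˡ (pos X) (fstᵛ 𝓣 P N)) (++⁻ˡ (neg X) (sndᵛ 𝓣 P N)) (trdᵛ 𝓣 P N)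
      (trans (map-++⁻ˡ (subᵗ ε) (pos X) _) (cong (++⁻ˡ (pos X)) (subˢ-fstᵛ ac bd γ)))
      (trans (map-++⁻ˡ (subᵗ ε) (neg X) _) (cong (++⁻ˡ (neg X)) (subˢ-sndᵛ ac bd γ)))
      (subˢ-trdᵛ ac bd γ))
    (sub-⟨,,⟩ Y ε (++⁻ʳ (pos X) (fstᵛ 𝓣 P N)) (++⁻ʳ (neg X) (sndᵛ 𝓣 P N)) (trdᵛ 𝓣 P N)
      (trans (map-++⁻ʳ (subᵗ ε) (pos X) _) (cong (++⁻ʳ (pos X)) (subˢ-fstᵛ ac bd γ)))
      (trans (map-++⁻ʳ (subᵗ ε) (neg X) _) (cong (++⁻ʳ (neg X)) (subˢ-sndᵛ ac bd γ)))
      (subˢ-trdᵛ ac bd γ)))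
    where
    P N : List (Type Base)
    P = pos X ++ pos Y
    N = neg X ++ neg Y
    ε : TTms _ (P ++ N ++ Γ)
    ε = ++⁺ ac (++⁺ bd γ)

  module _ (X Y : Interp 𝓣 Γ) where

    private
      F G : List (Type Base)
      F = map (pos X ⇒*_) (pos Y)
      G = map (λ ρ → pos X ⇒* (neg Y ⇒* (ρ *))) (neg X)

    ⟨⊃⟩ : (fg : TTms Δ (F ++ G)) (ad : TTms Δ (pos X ++ neg Y)) → ∀ γ →
          let a = ++⁻ˡ (pos X) ad ; d = ++⁻ʳ (pos X) ad in
          ⟨ _⊃ᵢ_ 𝓣 X Y ⟩ fg ad γ ≡
          (⟨ X ⟩∈ a (app (neg Y) (app (pos X) (++⁻ʳ F fg) a) d) γ ⊃
           ⟨ Y ⟩ (apps (pos X) (++⁻ˡ F fg) a) d γ)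
    ⟨⊃⟩ fg ad γ = trans (⟨⟩-at (_⊃ᵢ_ 𝓣 X Y) fg ad γ) (cong₂ _⊃_
      (sub-⟨,,⟩∈ X ε a (app (neg Y) (app (pos X) g a) d) (trdᵛ 𝓣 P N) a-eq
        (trans (subˢ-app (neg Y) ε (app (pos X) g a) d)
          (cong₂ (app (neg Y))
            (trans (subˢ-app (pos X) ε g a) (cong₂ (app (pos X)) g-eq a-eq)) d-eq))
        γ-eq)
      (sub-⟨,,⟩ Y ε (apps (pos X) f a) d (trdᵛ 𝓣 P N)
        (trans (subˢ-apps (pos X) ε f a) (cong₂ (apps (pos X)) f-eq a-eq)) d-eq γ-eq))
      where
      P N : List (Type Base)
      P = F ++ G
      N = pos X ++ neg Y
      ε : TTms _ (P ++ N ++ Γ)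
      ε = ++⁺ fg (++⁺ ad γ)
      f : TTms (P ++ N ++ Γ) F
      f = ++⁻ˡ F (fstᵛ 𝓣 P N)
      g : TTms (P ++ N ++ Γ) G
      g = ++⁻ʳ F (fstᵛ 𝓣 P N)
      a : TTms (P ++ N ++ Γ) (pos X)
      a = ++⁻ˡ (pos X) (sndᵛ 𝓣 P N)
      d : TTms (P ++ N ++ Γ) (neg Y)
      d = ++⁻ʳ (pos X) (sndᵛ 𝓣 P N)
      f-eq : subˢ ε f ≡ ++⁻ˡ F fg
      f-eq = trans (map-++⁻ˡ (subᵗ ε) F _) (cong (++⁻ˡ F) (subˢ-fstᵛ fg ad γ))
      g-eq : subˢ ε g ≡ ++⁻ʳ F fg
      g-eq = trans (map-++⁻ʳ (subᵗ ε) F _) (cong (++⁻ʳ F) (subˢ-fstᵛ fg ad γ))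
      a-eq : subˢ ε a ≡ ++⁻ˡ (pos X) ad
      a-eq = trans (map-++⁻ˡ (subᵗ ε) (pos X) _) (cong (++⁻ˡ (pos X)) (subˢ-sndᵛ fg ad γ))
      d-eq : subˢ ε d ≡ ++⁻ʳ (pos X) ad
      d-eq = trans (map-++⁻ʳ (subᵗ ε) (pos X) _) (cong (++⁻ʳ (pos X)) (subˢ-sndᵛ fg ad γ))
      γ-eq : subˢ ε (trdᵛ 𝓣 P N) ≡ γ
      γ-eq = subˢ-trdᵛ fg ad γ

  ⟨∀⟩ : (X : Interp 𝓣 (σ ∷ Γ)) (a : TTms Δ (pos X)) → ∀ b γ →
        ⟨ ∀ᵢ 𝓣 X ⟩ a b γ ≡ ∀′ tt (⟨ X ⟩ (subˢ wk₁ a) (subˢ wk₁ b) (lift γ))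
  ⟨∀⟩ {Γ = Γ} X a b γ = trans (⟨⟩-at (∀ᵢ 𝓣 X) a b γ) (cong (∀′ tt) (sub-⟨,,⟩ X (lift ε)
    (subˢ wk₁ (fstᵛ 𝓣 (pos X) (neg X))) (subˢ wk₁ (sndᵛ 𝓣 (pos X) (neg X)))
    (lift (trdᵛ 𝓣 (pos X) (neg X)))
    (trans (subˢ-lift-wk₁ ε _) (cong (subˢ wk₁) (subˢ-fstᵛ a b γ)))
    (trans (subˢ-lift-wk₁ ε _) (cong (subˢ wk₁) (subˢ-sndᵛ a b γ)))
    (trans (lift-subˢ ε _) (cong lift (subˢ-trdᵛ a b γ)))))
    where
    ε : TTms _ (pos X ++ neg X ++ Γ)
    ε = ++⁺ a (++⁺ b γ)

  ⟨∃⟩ : (X : Interp 𝓣 (σ ∷ Γ)) (a : TTms Δ (pos X)) → ∀ B γ →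
        ⟨ ∃ᵢ 𝓣 X ⟩ a B γ ≡ ∃′ tt (⟨ X ⟩∈ (subˢ wk₁ a) (subˢ wk₁ B) (lift γ))
  ⟨∃⟩ {Γ = Γ} X a B γ = trans (⟨⟩-at (∃ᵢ 𝓣 X) a B γ) (cong (∃′ tt) (sub-⟨,,⟩∈ X (lift ε)
    (subˢ wk₁ (fstᵛ 𝓣 (pos X) N)) (subˢ wk₁ (sndᵛ 𝓣 (pos X) N)) (lift (trdᵛ 𝓣 (pos X) N))
    (trans (subˢ-lift-wk₁ ε _) (cong (subˢ wk₁) (subˢ-fstᵛ a B γ)))
    (trans (subˢ-lift-wk₁ ε _) (cong (subˢ wk₁) (subˢ-sndᵛ a B γ)))
    (trans (lift-subˢ ε _) (cong lift (subˢ-trdᵛ a B γ)))))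
    where
    N : List (Type Base)
    N = map _* (neg X)
    ε : TTms _ (pos X ++ N ++ Γ)
    ε = ++⁺ a (++⁺ B γ)

  -- The interpretation commutes with substitution

  ids-blocks : ∀ Θ₁ Θ₂ {Γ} →
               ++⁺ (fstᵛ 𝓣 Θ₁ Θ₂) (++⁺ (sndᵛ 𝓣 Θ₁ Θ₂) (trdᵛ 𝓣 Θ₁ Θ₂ {Γ})) ≡ ids
  ids-blocks Θ₁ Θ₂ =
    trans (cong (++⁺ (fstᵛ 𝓣 Θ₁ Θ₂)) (++⁺-++⁻ Θ₂ (wks Θ₁))) (++⁺-++⁻ Θ₁ ids)

  -- A body is its own instance at the three blocks of variables, so it is determined by its
  -- instances. The laws for `subᵢ` therefore follow from the evaluation equations.
  interp-ext : ∀ {P N} {p : All Wit P} {n : All Wit N} {A B : TFm (P ++ N ++ Γ)} →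
               (∀ {Δ} (a : TTms Δ P) b γ →
                ⟨ interp p n A ⟩ a b γ ≡ ⟨ interp p n B ⟩ a b γ) →
               interp {𝓣 = 𝓣} p n A ≡ interp p n B
  interp-ext {P = P} {N} {p} {n} {A} {B} h = cong (interp p n)
    (trans (sym (body-eq A)) (trans (h (fstᵛ 𝓣 P N) (sndᵛ 𝓣 P N) (trdᵛ 𝓣 P N)) (body-eq B)))
    where
    body-eq : ∀ C → ⟨ interp p n C ⟩ (fstᵛ 𝓣 P N) (sndᵛ 𝓣 P N) (trdᵛ 𝓣 P N) ≡ C
    body-eq C = trans (⟨⟩-at (interp p n C) _ _ _)
      (trans (cong (λ γ → sub γ C) (ids-blocks P N)) (sub-ids C))

  module _ (δ : TTms Δ Γ) where

    subᵢ-subᵢ : (ε : TTms Γ Ξ) (X : Interp 𝓣 Ξ) →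
                subᵢ 𝓣 (subˢ δ ε) X ≡ subᵢ 𝓣 δ (subᵢ 𝓣 ε X)
    subᵢ-subᵢ ε X = interp-ext λ a b γ → trans (⟨subᵢ⟩ (subˢ δ ε) X a b γ)
      (trans (⟨⟩-cong X refl refl (subˢ-subˢ γ δ ε))
      (sym (trans (⟨subᵢ⟩ δ (subᵢ 𝓣 ε X) a b γ) (⟨subᵢ⟩ ε X a b (subˢ γ δ)))))

    subᵢ-∧ : (X Y : Interp 𝓣 Γ) →
             _∧ᵢ_ 𝓣 (subᵢ 𝓣 δ X) (subᵢ 𝓣 δ Y) ≡ subᵢ 𝓣 δ (_∧ᵢ_ 𝓣 X Y)
    subᵢ-∧ X Y = interp-ext λ a b γ → trans (⟨∧⟩ (subᵢ 𝓣 δ X) (subᵢ 𝓣 δ Y) a b γ)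
      (trans (cong₂ _∧_ (⟨subᵢ⟩ δ X _ _ γ) (⟨subᵢ⟩ δ Y _ _ γ))
      (sym (trans (⟨subᵢ⟩ δ (_∧ᵢ_ 𝓣 X Y) a b γ) (⟨∧⟩ X Y a b (subˢ γ δ)))))

    ⟨subᵢ⟩∈ : (X : Interp 𝓣 Γ) (a : TTms Ξ (pos X)) → ∀ B γ →
              ⟨ subᵢ 𝓣 δ X ⟩∈ a B γ ≡ ⟨ X ⟩∈ a B (subˢ γ δ)
    ⟨subᵢ⟩∈ X a B γ = begin
      ⟨ subᵢ 𝓣 δ X ⟩∈ a B γ
        ≡⟨ ⟨⟩∈-at (subᵢ 𝓣 δ X) a B γ ⟩
      ∀∈ (neg-wit X) B (⟨ subᵢ 𝓣 δ X ⟩ (subˢ w a) (++⁻ˡ (neg X) ids) (subˢ w γ))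
        ≡⟨ cong (∀∈ (neg-wit X) B) (trans (⟨subᵢ⟩ δ X _ _ _)
             (⟨⟩-cong X refl refl (sym (subˢ-subˢ w γ δ)))) ⟩
      ∀∈ (neg-wit X) B (⟨ X ⟩ (subˢ w a) (++⁻ˡ (neg X) ids) (subˢ w (subˢ γ δ)))
        ≡⟨ ⟨⟩∈-at X a B (subˢ γ δ) ⟨
      ⟨ X ⟩∈ a B (subˢ γ δ) ∎
      where
      open ≡-Reasoning
      w : TTms (neg X ++ _) _
      w = wks (neg X)

    subᵢ-⊃ : (X Y : Interp 𝓣 Γ) →
             _⊃ᵢ_ 𝓣 (subᵢ 𝓣 δ X) (subᵢ 𝓣 δ Y) ≡ subᵢ 𝓣 δ (_⊃ᵢ_ 𝓣 X Y)
    subᵢ-⊃ X Y = interp-ext λ a b γ → trans (⟨⊃⟩ (subᵢ 𝓣 δ X) (subᵢ 𝓣 δ Y) a b γ)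
      (trans (cong₂ _⊃_ (⟨subᵢ⟩∈ X _ _ γ) (⟨subᵢ⟩ δ Y _ _ γ))
      (sym (trans (⟨subᵢ⟩ δ (_⊃ᵢ_ 𝓣 X Y) a b γ) (⟨⊃⟩ X Y a b (subˢ γ δ)))))

  subᵢ-∀ : (δ : TTms Δ Γ) (X : Interp 𝓣 (σ ∷ Γ)) →
           ∀ᵢ 𝓣 (subᵢ 𝓣 (lift δ) X) ≡ subᵢ 𝓣 δ (∀ᵢ 𝓣 X)
  subᵢ-∀ δ X = interp-ext λ a b γ → trans (⟨∀⟩ (subᵢ 𝓣 (lift δ) X) a b γ)
    (trans (cong (∀′ tt) (trans (⟨subᵢ⟩ (lift δ) X _ _ _) (⟨⟩-cong X refl refl (lift-subˢ γ δ))))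
    (sym (trans (⟨subᵢ⟩ δ (∀ᵢ 𝓣 X) a b γ) (⟨∀⟩ X a b (subˢ γ δ)))))

  subᵢ-∃ : (δ : TTms Δ Γ) (X : Interp 𝓣 (σ ∷ Γ)) →
           ∃ᵢ 𝓣 (subᵢ 𝓣 (lift δ) X) ≡ subᵢ 𝓣 δ (∃ᵢ 𝓣 X)
  subᵢ-∃ δ X = interp-ext λ a b γ → trans (⟨∃⟩ (subᵢ 𝓣 (lift δ) X) a b γ)
    (trans (cong (∃′ tt) (trans (⟨subᵢ⟩∈ (lift δ) X _ _ _) (⟨⟩∈-cong X refl refl (lift-subˢ γ δ))))
    (sym (trans (⟨subᵢ⟩ δ (∃ᵢ 𝓣 X) a b γ) (⟨∃⟩ X a b (subˢ γ δ)))))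

  module _ (β : BaseInterpretation 𝓣) where
    open SourceTheory 𝓢 using (IFm)

    private
      𝒰 : IFm Γ → Interp 𝓣 Γ
      𝒰 = 𝒰⟦_⟧ 𝓣 β

    -- Identifies the interpretations of `B` and `C` weakened by k with weakenings of their
    -- interpretations. By `interp-ext` this is an honest equality, under which realizers transfer
    -- unchanged.
    𝒰-sub : (γ : Tms 𝓢.sig Δ Γ) (A : IFm Γ) → 𝒰 (sub γ A) ≡ subᵢ 𝓣 (All.map embed γ) (𝒰 A)
    𝒰-sub γ (rel r ts) =
      trans (cong (λ δ → subᵢ 𝓣 δ (β r)) (embed-subˢ γ ts))
            (subᵢ-subᵢ (All.map embed γ) (All.map embed ts) (β r))
    𝒰-sub γ (s ≈ t)    = cong (interp [] []) (cong₂ _≈_ (≈-eq s) (≈-eq t))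
      where
      -- With both witness blocks empty, `trdᵛ` is `ids`, and `subᵢ` still composes with it.
      ≈-eq : ∀ {τ} (t : Term 𝓢.sig _ τ) →
             embed (subᵗ γ t) ≡ subᵗ (subˢ ids (All.map embed γ)) (embed t)
      ≈-eq t = trans (embed-subᵗ γ t) (cong (λ δ → subᵗ δ (embed t)) (sym (subˢ-idˡ _)))
    𝒰-sub γ ⊥′         = refl
    𝒰-sub γ (A ∧ B)    = trans (cong₂ (_∧ᵢ_ 𝓣) (𝒰-sub γ A) (𝒰-sub γ B))
      (subᵢ-∧ (All.map embed γ) (𝒰 A) (𝒰 B))
    𝒰-sub γ (A ⊃ B)    = trans (cong₂ (_⊃ᵢ_ 𝓣) (𝒰-sub γ A) (𝒰-sub γ B))
      (subᵢ-⊃ (All.map embed γ) (𝒰 A) (𝒰 B))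
    𝒰-sub γ (∀′ s A)   = trans (cong (∀ᵢ 𝓣) (trans (𝒰-sub (lift γ) A)
      (cong (λ δ → subᵢ 𝓣 δ (𝒰 A)) (embed-lift γ)))) (subᵢ-∀ (All.map embed γ) (𝒰 A))
    𝒰-sub γ (∃′ s A)   = trans (cong (∃ᵢ 𝓣) (trans (𝒰-sub (lift γ) A)
      (cong (λ δ → subᵢ 𝓣 δ (𝒰 A)) (embed-lift γ)))) (subᵢ-∃ (All.map embed γ) (𝒰 A))

  -- Derivations in the target theory

  cast : ∀ {A B : TFm Γ} → A ≡ B → Γ ∣ Φ ⊢ A → Γ ∣ Φ ⊢ B
  cast {Γ = Γ} {Φ} = subst (Γ ∣ Φ ⊢_)

  module _ {Γ : List (Type Base)} {Φ : List (TFm Γ)} where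

    ≈-sym : ∀ {s t : TTm Γ σ} → Γ ∣ Φ ⊢ s ≈ t → Γ ∣ Φ ⊢ t ≈ s
    ≈-sym {s = s} {t} e = cast (cong (t ≈_) (subᵗ-wk₁-⁻¹ t s))
      (≈-subst (v₀ ≈ subᵗ wk₁ s) e (cast (cong (s ≈_) (sym (subᵗ-wk₁-⁻¹ s s))) ≈-refl))

    ≈-trans : ∀ {s t u : TTm Γ σ} → Γ ∣ Φ ⊢ s ≈ t → Γ ∣ Φ ⊢ t ≈ u → Γ ∣ Φ ⊢ s ≈ u
    ≈-trans {s = s} {t} {u} d e = cast (cong (_≈ u) (subᵗ-wk₁-⁻¹ u s))
      (≈-subst (subᵗ wk₁ s ≈ v₀) e (cast (cong (_≈ t) (sym (subᵗ-wk₁-⁻¹ t s))) d))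

    ≡⇒≈ : ∀ {s t : TTm Γ σ} → s ≡ t → Γ ∣ Φ ⊢ s ≈ t
    ≡⇒≈ refl = ≈-refl

    ·-cong : ∀ {f g : TTm Γ (σ ⇒ τ)} {s t} → Γ ∣ Φ ⊢ f ≈ g → Γ ∣ Φ ⊢ s ≈ t →
             Γ ∣ Φ ⊢ f · s ≈ g · t
    ·-cong {f = f} {g} {s} {t} d e = ≈-trans
      (cast (cong₂ _≈_ (f-eq s g) (cong (g ·_) (subᵗ-wk₁-⁻¹ g s)))
        (≈-subst (subᵗ wk₁ (f · s) ≈ v₀ · subᵗ wk₁ s) d
          (cast (sym (cong₂ _≈_ (f-eq s f) (cong (f ·_) (subᵗ-wk₁-⁻¹ f s)))) ≈-refl)))
      (cast (cong₂ _≈_ (subᵗ-wk₁-⁻¹ t (g · s)) (cong (_· t) (subᵗ-wk₁-⁻¹ t g)))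
        (≈-subst (subᵗ wk₁ (g · s) ≈ subᵗ wk₁ g · v₀) e
          (cast (sym (cong₂ _≈_ (subᵗ-wk₁-⁻¹ s (g · s)) (cong (_· s) (subᵗ-wk₁-⁻¹ s g)))) ≈-refl)))
      where
      f-eq : ∀ s h → subᵗ (h ∷ ids) (subᵗ wk₁ (f · s)) ≡ f · s
      f-eq s h = subᵗ-wk₁-⁻¹ h (f · s)

    app₁-cong : ∀ ρs {f g : TTm Γ (ρs ⇒* τ)} as → Γ ∣ Φ ⊢ f ≈ g →
                Γ ∣ Φ ⊢ app₁ ρs f as ≈ app₁ ρs g as
    app₁-cong []       []       e = e
    app₁-cong (ρ ∷ ρs) (a ∷ as) e = app₁-cong ρs as (·-cong e ≈-refl)

  -- Bracket abstraction and provable equality of tuples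

  lam : TTm (σ ∷ Γ) τ → TTm Γ (σ ⇒ τ)
  lam {σ = σ} (var (here refl)) =
    con (S {σ = σ ⇒ σ} tt tt tt) · con (K tt tt) · con (K {τ = σ} tt tt)
  lam (var (there i)) = con (K tt tt) · var i
  lam (con c)         = con (K tt tt) · con c
  lam (s · t)         = con (S tt tt tt) · lam s · lam t

  -- Stated under a substitution because `lam` does not commute with substitution syntactically: a
  -- variable may be replaced by an application, which is abstracted with `S` instead of `K`.
  lam-β : (γ : TTms Δ Γ) (a : TTm Δ σ) (t : TTm (σ ∷ Γ) τ) →
          Δ ∣ Φ ⊢ subᵗ γ (lam t) · a ≈ subᵗ (a ∷ γ) t
  lam-β γ a (var (here refl)) = ≈-trans S-eq K-eq
  lam-β γ a (var (there i))   = K-eq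
  lam-β γ a (con c)           = K-eq
  lam-β γ a (s · t)           = ≈-trans S-eq (·-cong (lam-β γ a s) (lam-β γ a t))

  -- The first argument needs the outermost abstraction, while its variable is the innermost one in
  -- `ρ ∷ ρs ++ Γ`; it has to move behind `ρs`.
  exchange : ∀ ρs → TTms (ρs ++ ρ ∷ Γ) (ρ ∷ ρs ++ Γ)
  exchange ρs = subᵗ (wks ρs) v₀ ∷ ++⁺ (++⁻ˡ ρs ids) (subˢ (wks ρs) wk₁)

  subˢ-exchange : ∀ ρs (as : TTms Δ ρs) (a : TTm Δ ρ) (γ : TTms Δ Γ) →
                  subˢ (++⁺ as (a ∷ γ)) (exchange ρs) ≡ a ∷ ++⁺ as γ
  subˢ-exchange ρs as a γ = cong₂ _∷_
    (trans (subᵗ-subᵗ ε (wks ρs) v₀) (cong (λ δ → subᵗ δ v₀) (subˢ-wks as (a ∷ γ))))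
    (trans (map-++⁺ (subᵗ ε) (++⁻ˡ ρs ids) (subˢ (wks ρs) wk₁))
      (cong₂ ++⁺ (subˢ-fst as (a ∷ γ))
        (trans (subˢ-subˢ-wks as (a ∷ γ) wk₁) (subˢ-wk₁ a γ))))
    where
    ε : TTms _ _
    ε = ++⁺ as (a ∷ γ)

  lams : ∀ ρs → TTm (ρs ++ Γ) τ → TTm Γ (ρs ⇒* τ)
  lams []       t = t
  lams (ρ ∷ ρs) t = lam (lams ρs (subᵗ (exchange ρs) t))

  lams-β : ∀ ρs (as : TTms Δ ρs) (γ : TTms Δ Γ) (t : TTm (ρs ++ Γ) τ) →
           Δ ∣ Φ ⊢ app₁ ρs (subᵗ γ (lams ρs t)) as ≈ subᵗ (++⁺ as γ) t
  lams-β []       []       γ t = ≈-refl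
  lams-β (ρ ∷ ρs) (a ∷ as) γ t =
    ≈-trans (app₁-cong ρs as (lam-β γ a (lams ρs t′)))
      (≈-trans (lams-β ρs as (a ∷ γ) t′)
        (≡⇒≈ (trans (subᵗ-subᵗ (++⁺ as (a ∷ γ)) (exchange ρs) t)
                    (cong (λ δ → subᵗ δ t) (subˢ-exchange ρs as a γ)))))
    where
    t′ : TTm (ρs ++ ρ ∷ _) _
    t′ = subᵗ (exchange ρs) t

  infix 10 _∣_⊢_≋_

  data _∣_⊢_≋_ (Δ : List (Type Base)) (Φ : List (TFm Δ)) :
               ∀ {Θ} → TTms Δ Θ → TTms Δ Θ → Set where
    []  : Δ ∣ Φ ⊢ [] ≋ []
    _∷_ : ∀ {ρ Θ} {s t : TTm Δ ρ} {ss ts : TTms Δ Θ} →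
          Δ ∣ Φ ⊢ s ≈ t → Δ ∣ Φ ⊢ ss ≋ ts → Δ ∣ Φ ⊢ (s ∷ ss) ≋ (t ∷ ts)

  ≋-subst : (A : TFm (Θ ++ Δ)) {ss ts : TTms Δ Θ} → Δ ∣ Φ ⊢ ss ≋ ts →
            Δ ∣ Φ ⊢ sub (++⁺ ss ids) A → Δ ∣ Φ ⊢ sub (++⁺ ts ids) A
  ≋-subst A [] d = d
  ≋-subst {Θ = ρ ∷ Θ} {Δ = Δ} A (_∷_ {s = s} {t} {ss} {ts} e es) d =
    -- The head is replaced while the tail is still `ss`; with `t` then fixed in the formula, the
    -- tail is replaced by recursion.
    cast (t-eq ts) (≋-subst (sub (subᵗ (wks Θ) t ∷ ids) A) es (cast (sym (t-eq ss))
      (cast (sub-lift-[] t (++⁺ ss ids) A)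
        (≈-subst (sub (lift (++⁺ ss ids)) A) e (cast (sym (sub-lift-[] s (++⁺ ss ids) A)) d)))))
    where
    t-eq : ∀ us → sub (++⁺ us ids) (sub (subᵗ (wks Θ) t ∷ ids) A) ≡ sub (t ∷ ++⁺ us ids) A
    t-eq us = trans (sub-sub (++⁺ us ids) (subᵗ (wks Θ) t ∷ ids) A)
      (cong (λ δ → sub δ A) (cong₂ _∷_
        (trans (subᵗ-subᵗ (++⁺ us ids) (wks Θ) t)
          (trans (cong (λ δ → subᵗ δ t) (subˢ-wks us ids)) (subᵗ-ids t)))
        (subˢ-idʳ (++⁺ us ids))))

  -- Bounded quantification over tuples

  -- `Q` is either derivability or being a hypothesis. The latter passes under binders by weakening
  -- formulas only, with no weakening of derivations.
  data Mems {Δ : List (Type Base)} (Q : TFm Δ → Set) :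
            ∀ {Θ} → All Wit Θ → TTms Δ Θ → TTms Δ (map _* Θ) → Set where
    []  : Mems Q [] [] []
    _∷_ : ∀ {ρ Θ} {w : Wit ρ} {ws : All Wit Θ} {b bs B Bs} →
          Q (mem′ w b B) → Mems Q ws bs Bs → Mems Q (w ∷ ws) (b ∷ bs) (B ∷ Bs)

  Mems-map : ∀ {Δ Δ′} {Q : TFm Δ → Set} {Q′ : TFm Δ′ → Set} (γ : TTms Δ′ Δ)
             {ws : All Wit Θ} {bs Bs} → (∀ {A} → Q A → Q′ (sub γ A)) →
             Mems Q ws bs Bs → Mems Q′ ws (subˢ γ bs) (subˢ γ Bs)
  Mems-map γ h []       = []
  Mems-map γ h (m ∷ ms) = h m ∷ Mems-map γ h ms

  Mems-remove : ∀ {Q : TFm Δ → Set} {Θ₁ Θ₂} (ws : All Wit Θ₁) {w : Wit ρ} {vs : All Wit Θ₂}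
                {bs Bs} →
                Mems Q (++⁺ ws (w ∷ vs)) bs Bs →
                Mems Q (++⁺ ws vs) (remove Θ₁ bs) (map⁺ (remove Θ₁ (map⁻ Bs)))
  Mems-remove []       (m ∷ ms) = subst (Mems _ _ _) (sym (map⁺-map⁻ _)) ms
  Mems-remove (v ∷ ws) (m ∷ ms) = m ∷ Mems-remove ws ms

  Mems-middle : ∀ {Q : TFm Δ → Set} {Θ₁ Θ₂} (ws : All Wit Θ₁) {w : Wit ρ} {vs : All Wit Θ₂}
                {bs Bs} →
                Mems Q (++⁺ ws (w ∷ vs)) bs Bs →
                Q (mem′ w (middle Θ₁ bs) (middle Θ₁ (map⁻ Bs)))
  Mems-middle []       (m ∷ ms) = m
  Mems-middle (v ∷ ws) (m ∷ ms) = Mems-middle ws ms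

  ∀∈-E : (ws : All Wit Θ) {bs : TTms Δ Θ} {Bs : TTms Δ (map _* Θ)} (A : TFm (Θ ++ Δ)) →
         Δ ∣ Φ ⊢ ∀∈ ws Bs A → Mems (Δ ∣ Φ ⊢_) ws bs Bs → Δ ∣ Φ ⊢ sub (++⁺ bs ids) A
  ∀∈-E [] A d [] = cast (sym (sub-ids A)) d
  ∀∈-E {Θ = ρ ∷ Θ} (w ∷ ws) {b ∷ bs} {B ∷ Bs} A d (m ∷ ms) = ⊃-E
    (cast (trans (sub-lift-[] b (++⁺ bs ids) (mem′ w v₀ (subᵗ (wks (ρ ∷ Θ)) B) ⊃ A))
                 (cong (λ C → mem′ w b C ⊃ sub (++⁺ (b ∷ bs) ids) A) B-eq))
      -- `∀∈` quantifies the head innermost, so the tail is instantiated before it.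
      (∀-E (∀∈-E ws (∀′ tt (mem′ w v₀ (subᵗ (wks (ρ ∷ Θ)) B) ⊃ A)) d ms) b))
    m
    where
    B-eq : subᵗ (++⁺ (b ∷ bs) ids) (subᵗ (wks (ρ ∷ Θ)) B) ≡ B
    B-eq = trans (subᵗ-subᵗ (++⁺ (b ∷ bs) ids) (wks (ρ ∷ Θ)) B)
      (trans (cong (λ δ → subᵗ δ B) (subˢ-wks (b ∷ bs) ids)) (subᵗ-ids B))

  -- The assumptions in force under the whole prefix of `∀∈`; each further binder weakens all those
  -- introduced outside it.
  hyps : All Wit Θ → TTms Δ (map _* Θ) → List (TFm Δ) → List (TFm (Θ ++ Δ))
  hyps []                   []       Φ = Φ
  hyps {Θ = ρ ∷ Θ} (w ∷ ws) (B ∷ Bs) Φ =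
    mem′ w v₀ (subᵗ (wks (ρ ∷ Θ)) B) ∷ map wk (hyps ws Bs Φ)

  ∀∈-I : (ws : All Wit Θ) (Bs : TTms Δ (map _* Θ)) {A : TFm (Θ ++ Δ)} →
         (Θ ++ Δ) ∣ hyps ws Bs Φ ⊢ A → Δ ∣ Φ ⊢ ∀∈ ws Bs A
  ∀∈-I []       []       d = d
  ∀∈-I (w ∷ ws) (B ∷ Bs) d = ∀∈-I ws Bs (∀-I (⊃-I d))

  hyps-wks : (ws : All Wit Θ) (Bs : TTms Δ (map _* Θ)) {A : TFm Δ} →
             A ∈ Φ → sub (wks Θ) A ∈ hyps ws Bs Φ
  hyps-wks [] [] {A} i = subst (_∈ _) (sym (sub-ids A)) i
  hyps-wks {Θ = ρ ∷ Θ} (w ∷ ws) (B ∷ Bs) {A} i = there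
    (subst (_∈ _) (trans (sub-sub wk₁ (wks Θ) A) (cong (λ δ → sub δ A) (sym (wks-∷ Θ))))
      (∈-map⁺ wk (hyps-wks ws Bs i)))

  hyps-Mems : (ws : All Wit Θ) (Bs : TTms Δ (map _* Θ)) →
              Mems (_∈ hyps ws Bs Φ) ws (++⁻ˡ Θ ids) (subˢ (wks Θ) Bs)
  hyps-Mems []                   []       = []
  hyps-Mems {Θ = ρ ∷ Θ} (w ∷ ws) (B ∷ Bs) = here refl ∷
    subst₂ (Mems _ ws)
      (trans (map-++⁻ˡ (subᵗ wk₁) Θ ids) (cong (++⁻ˡ Θ) (subˢ-idʳ wk₁)))
      (trans (subˢ-subˢ wk₁ (wks Θ) Bs) (cong (λ δ → subˢ δ Bs) (sym (wks-∷ Θ))))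
      (Mems-map wk₁ (there ∘ ∈-map⁺ wk) (hyps-Mems ws Bs))

  module _ (X : Interp 𝓣 Γ) where

    ⟨⟩∈-E : {a : TTms Δ (pos X)} {b : TTms Δ (neg X)} {B : TTms Δ (map _* (neg X))} {γ : TTms Δ Γ} →
            Δ ∣ Φ ⊢ ⟨ X ⟩∈ a B γ → Mems (Δ ∣ Φ ⊢_) (neg-wit X) b B → Δ ∣ Φ ⊢ ⟨ X ⟩ a b γ
    ⟨⟩∈-E {a = a} {b} {B} {γ} d ms = cast
      (trans (sub-⟨⟩ X (++⁺ b ids) _ _ _)
        (⟨⟩-cong X (trans (subˢ-subˢ-wks b ids a) (subˢ-idˡ a)) (subˢ-fst b ids)
          (trans (subˢ-subˢ-wks b ids γ) (subˢ-idˡ γ))))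
      (∀∈-E (neg-wit X) _ (cast (⟨⟩∈-at X a B γ) d) ms)

    ⟨⟩∈-I : {a : TTms Δ (pos X)} {B : TTms Δ (map _* (neg X))} {γ : TTms Δ Γ} →
            (neg X ++ Δ) ∣ hyps (neg-wit X) B Φ ⊢
              ⟨ X ⟩ (subˢ (wks (neg X)) a) (++⁻ˡ (neg X) ids) (subˢ (wks (neg X)) γ) →
            Δ ∣ Φ ⊢ ⟨ X ⟩∈ a B γ
    ⟨⟩∈-I {a = a} {B} {γ} d = cast (sym (⟨⟩∈-at X a B γ)) (∀∈-I (neg-wit X) B d)

  module _ (X : Interp 𝓣 (σ ∷ Γ)) {a : TTms Δ (pos X)} {γ : TTms Δ Γ} where

    ⟨∀⟩-E : ∀ {b} → Δ ∣ Φ ⊢ ⟨ ∀ᵢ 𝓣 X ⟩ a b γ → ∀ t → Δ ∣ Φ ⊢ ⟨ X ⟩ a b (t ∷ γ)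
    ⟨∀⟩-E {b = b} d t = cast
      (trans (sub-⟨⟩ X (t ∷ ids) _ _ _) (⟨⟩-cong X (subˢ-wk₁-⁻¹ t a) (subˢ-wk₁-⁻¹ t b)
        (trans (subˢ-lift t ids γ) (cong (t ∷_) (subˢ-idˡ γ)))))
      (∀-E (cast (⟨∀⟩ X a b γ) d) t)

    ⟨∃⟩-I : ∀ {B} t → Δ ∣ Φ ⊢ ⟨ X ⟩∈ a B (t ∷ γ) → Δ ∣ Φ ⊢ ⟨ ∃ᵢ 𝓣 X ⟩ a B γ
    ⟨∃⟩-I {B = B} t d = cast (sym (⟨∃⟩ X a B γ)) (∃-I t (cast
      (sym (trans (sub-⟨⟩∈ X (t ∷ ids) _ _ _) (⟨⟩∈-cong X (subˢ-wk₁-⁻¹ t a) (subˢ-wk₁-⁻¹ t B)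
        (trans (subˢ-lift t ids γ) (cong (t ∷_) (subˢ-idˡ γ)))))) d))

  -- Realizability

  -- Demanding derivability under every substitution and from all assumptions
  -- makes substitution and weakening of derivations unnecessary.
  Realized : Interp 𝓣 Γ → Set
  Realized {Γ = Γ} X = Σ (TTms [] (pos X)) λ t →
    ∀ {Δ Φ} b (γ : TTms Δ Γ) → Δ ∣ Φ ⊢ ⟨ X ⟩ (subˢ [] t) b γ

  ∀∀-I : ∀ Θ {A : TFm (Θ ++ Γ)} → (Θ ++ Γ) ∣ [] ⊢ A → Γ ∣ [] ⊢ ∀∀ Θ A
  ∀∀-I []      d = d
  ∀∀-I (ρ ∷ Θ) d = ∀∀-I Θ (∀-I d)

  module _ (β : BaseInterpretation 𝓣) where
    open SourceTheory 𝓢 using (IFm; Sort)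

    Realized⇒𝒰-Interpretable : (A : IFm Γ) → Realized (𝒰⟦_⟧ 𝓣 β A) → 𝒰-Interpretable 𝓣 β A
    Realized⇒𝒰-Interpretable A (t , d) = t , ∀∀-I (neg X) (cast
      (sym (⟨⟩-unfold X (subˢ [] t) (++⁻ˡ (neg X) ids) (wks (neg X)))) (d _ _))
      where
      X : Interp 𝓣 _
      X = 𝒰⟦_⟧ 𝓣 β A

    Realized-∀ : (X : Interp 𝓣 (σ ∷ Γ)) → Realized X → Realized (∀ᵢ 𝓣 X)
    Realized-∀ X (t , d) = t , λ b γ → cast (sym (⟨∀⟩ X _ b γ))
      (∀-I (cast (⟨⟩-cong X (sym (subˢ-subˢ wk₁ [] t)) refl refl) (d _ _)))

    Realized-close : (ss : All Sort Γ) (A : IFm Γ) →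
                     Realized (𝒰⟦_⟧ 𝓣 β A) → Realized (𝒰⟦_⟧ 𝓣 β (close ss A))
    Realized-close []       A r = r
    Realized-close (s ∷ ss) A r = Realized-close ss (∀′ s A) (Realized-∀ (𝒰⟦_⟧ 𝓣 β A) r)

  module _ {Δ : List (Type Base)} {Φ : List (TFm Δ)} where

    apps-lams-β : ∀ Ξ {Θ} (a : TTms Δ Ξ) (f : TTms (Ξ ++ []) Θ) →
                  Δ ∣ Φ ⊢ subˢ (++⁺ a []) f ≋
                          apps Ξ (subˢ [] (map⁺ {f = Ξ ⇒*_} (All.map (lams Ξ) f))) a
    apps-lams-β Ξ a []      = []
    apps-lams-β Ξ a (t ∷ f) = ≈-sym (lams-β Ξ a [] t) ∷ apps-lams-β Ξ a f

    app-lams-β : ∀ Ξ₁ Ξ₂ {Θ} (a : TTms Δ Ξ₁) (d : TTms Δ Ξ₂)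
                 (g : TTms (Ξ₂ ++ Ξ₁ ++ []) (map _* Θ)) →
                 Δ ∣ Φ ⊢ subˢ (++⁺ d (++⁺ a [])) g ≋
                   app Ξ₂ (app Ξ₁ (subˢ [] (map⁺ {f = λ ρ → Ξ₁ ⇒* (Ξ₂ ⇒* (ρ *))}
                     (All.map (lams Ξ₁ ∘ lams Ξ₂) (map⁻ g)))) a) d
    app-lams-β Ξ₁ Ξ₂ {[]}    a d []      = []
    app-lams-β Ξ₁ Ξ₂ {ρ ∷ Θ} a d (t ∷ g) =
      ≈-sym (≈-trans (app₁-cong Ξ₂ d (lams-β Ξ₁ a [] (lams Ξ₂ t))) (lams-β Ξ₂ d (++⁺ a []) t)) ∷
      app-lams-β Ξ₁ Ξ₂ a d g

  module _ (X Y : Interp 𝓣 Γ) where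

    -- Allows open terms as realizers: `f` in the variables a, `g` in d and a, with d in front
    -- because it is abstracted first. Abstraction closes them, and `≋-subst` carries the derivation
    -- along the β-equations, once on each side of the implication.
    Realized-⊃ : (f : TTms (pos X ++ []) (pos Y))
                 (g : TTms (neg Y ++ pos X ++ []) (map _* (neg X))) →
                 (∀ {Δ Φ} a d (γ : TTms Δ Γ) → Δ ∣ Φ ⊢
                   ⟨ X ⟩∈ a (subˢ (++⁺ d (++⁺ a [])) g) γ ⊃ ⟨ Y ⟩ (subˢ (++⁺ a []) f) d γ) →
                 Realized (_⊃ᵢ_ 𝓣 X Y)
    Realized-⊃ f g h = ++⁺ F G , λ {Δ} {Φ} ad γ →
      let a  = ++⁻ˡ (pos X) ad
          d  = ++⁻ʳ (pos X) ad
          FG = map-++⁺ (subᵗ []) F G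
          F′ = trans (cong (++⁻ˡ _) FG) (++⁻ˡ-++⁺ (subˢ [] F) (subˢ [] G))
          G′ = trans (cong (++⁻ʳ (map (pos X ⇒*_) (pos Y))) FG) (++⁻ʳ-++⁺ (subˢ [] F) (subˢ [] G))
          -- For `≋-subst` the arguments to be replaced become a fresh block of variables. `X-eq`
          -- and `Y-eq` fill that block, and `wk-eq` shows that the other side of the implication is
          -- unaffected.
          X-eq : ∀ B → sub (++⁺ B ids) (⟨ X ⟩∈ (subˢ (wks (map _* (neg X))) a)
                         (++⁻ˡ (map _* (neg X)) ids) (subˢ (wks (map _* (neg X))) γ)) ≡ ⟨ X ⟩∈ a B γ
          X-eq = λ B → trans (sub-⟨⟩∈ X (++⁺ B ids) _ _ _) (⟨⟩∈-cong X
            (trans (subˢ-subˢ-wks B ids a) (subˢ-idˡ a)) (subˢ-fst B ids)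
            (trans (subˢ-subˢ-wks B ids γ) (subˢ-idˡ γ)))
          Y-eq : ∀ e → sub (++⁺ e ids) (⟨ Y ⟩ (++⁻ˡ (pos Y) ids)
                         (subˢ (wks (pos Y)) d) (subˢ (wks (pos Y)) γ)) ≡ ⟨ Y ⟩ e d γ
          Y-eq = λ e → trans (sub-⟨⟩ Y (++⁺ e ids) _ _ _) (⟨⟩-cong Y (subˢ-fst e ids)
            (trans (subˢ-subˢ-wks e ids d) (subˢ-idˡ d))
            (trans (subˢ-subˢ-wks e ids γ) (subˢ-idˡ γ)))
          wk-eq : ∀ {Θ} (e : TTms Δ Θ) A → sub (++⁺ e ids) (sub (wks Θ) A) ≡ A
          wk-eq = λ {Θ} e A → trans (sub-sub (++⁺ e ids) (wks Θ) A)
            (trans (cong (λ δ → sub δ A) (subˢ-wks e ids)) (sub-ids A))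
      in cast (sym (trans (⟨⊃⟩ X Y (subˢ [] (++⁺ F G)) ad γ)
           (cong₂ _⊃_ (⟨⟩∈-cong X refl (cong (λ z → app (neg Y) (app (pos X) z a) d) G′) refl)
                      (⟨⟩-cong Y (cong (λ z → apps (pos X) z a) F′) refl refl))))
         (cast (cong₂ _⊃_ (wk-eq _ _) (Y-eq _))
           (≋-subst (sub (wks (pos Y)) (⟨ X ⟩∈ a _ γ) ⊃ ⟨ Y ⟩ _ _ _) (apps-lams-β (pos X) a f)
             (cast (sym (cong₂ _⊃_ (wk-eq _ _) (Y-eq _)))
               (cast (cong₂ _⊃_ (X-eq _) (wk-eq _ _))
                 (≋-subst (⟨ X ⟩∈ _ _ _ ⊃ sub (wks (map _* (neg X)))
                                                (⟨ Y ⟩ (subˢ (++⁺ a []) f) d γ))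
                   (app-lams-β (pos X) (neg Y) a d g)
                   (cast (sym (cong₂ _⊃_ (X-eq _) (wk-eq _ _))) (h a d γ)))))))
      where
      F : TTms [] (map (pos X ⇒*_) (pos Y))
      F = map⁺ (All.map (lams (pos X)) f)
      G : TTms [] (map (λ ρ → pos X ⇒* (neg Y ⇒* (ρ *))) (neg X))
      G = map⁺ (All.map (lams (pos X) ∘ lams (neg Y)) (map⁻ g))

    Realized-⊃-const : Realized Y → Realized (_⊃ᵢ_ 𝓣 X Y)
    Realized-⊃-const (t , d) = Realized-⊃ (subˢ [] t)
      -- Sets of witnesses are non-empty, so some element has to be given; any closed one will do.
      (map⁺ (All.map (λ w → single′ w (subᵗ [] (inhabitant w))) (neg-wit X)))
      λ a b γ → ⊃-I (cast (⟨⟩-cong Y (sym (subˢ-subˢ (++⁺ a []) [] t)) refl refl) (d b γ))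

  -- Bounded collection

  module _ {Γ : List (Type Base)} where

    singles : All Wit Θ → TTms Γ Θ → TTms Γ (map _* Θ)
    singles []       []       = []
    singles (w ∷ ws) (t ∷ ts) = single′ w t ∷ singles ws ts

    Mems-singles : (ws : All Wit Θ) (ts : TTms Γ Θ) → Mems (Γ ∣ Φ ⊢_) ws ts (singles ws ts)
    Mems-singles []       []       = []
    Mems-singles (w ∷ ws) (t ∷ ts) = single-I ∷ Mems-singles ws ts

  subˢ-singles : (γ : TTms Δ Γ) (ws : All Wit Θ) (ts : TTms Γ Θ) →
                 subˢ γ (singles ws ts) ≡ singles ws (subˢ γ ts)
  subˢ-singles γ []       []       = refl
  subˢ-singles γ (w ∷ ws) (t ∷ ts) = cong (_ ∷_) (subˢ-singles γ ws ts)

  ∀≤-mono : ∀ {k m : TTm Δ nat} {A : TFm (nat ∷ Δ)} → Δ ∣ Φ ⊢ m ≤ k →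
            Δ ∣ Φ ⊢ ∀′ tt (v₀ ≤ subᵗ wk₁ k ⊃ A) → Δ ∣ Φ ⊢ ∀′ tt (v₀ ≤ subᵗ wk₁ m ⊃ A)
  -- `d` and `e` are cut in as hypotheses, which `∀-I` weakens as formulas; the derivations
  -- themselves stay outside the binder.
  ∀≤-mono {k = k} {m} {A} d e = ⊃-E (⊃-E (⊃-I (⊃-I (∀-I (⊃-I
    (⊃-E (cast v₀-eq (∀-E (hyp (there (there (here refl)))) v₀))
         (≤-trans (hyp (here refl)) (hyp (there (here refl))))))))) e) d
    where
    v₀-eq : sub (lift wk₁) (v₀ ≤ subᵗ wk₁ k ⊃ A) [ v₀ ] ≡ (v₀ ≤ subᵗ wk₁ k ⊃ A)
    v₀-eq = trans (sub-lift-[] v₀ wk₁ (v₀ ≤ subᵗ wk₁ k ⊃ A)) (sub-ids (v₀ ≤ subᵗ wk₁ k ⊃ A))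

  -- The common shape of both sides under ∃x: `J` is n ≤ k in the premise and 𝓘(n) in the
  -- conclusion.
  matrixᵢ : Interp 𝓣 Γ → Interp 𝓣 (σ ∷ Γ) → Interp 𝓣 (σ ∷ Γ) → Interp 𝓣 Γ
  matrixᵢ B J C = _∧ᵢ_ 𝓣 B (∀ᵢ 𝓣 (_⊃ᵢ_ 𝓣 J C))

  collectionᵢ : Interp 𝓣 (nat ∷ Γ) → Interp 𝓣 (σ ∷ nat ∷ Γ) → Interp 𝓣 (σ ∷ Γ) → Interp 𝓣 Γ
  collectionᵢ J Z Y = _⊃ᵢ_ 𝓣 (∀ᵢ 𝓣 (_⊃ᵢ_ 𝓣 J (∃ᵢ 𝓣 Z))) (∃ᵢ 𝓣 Y)

  module _ (w : Wit nat) where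

    𝓘ₙ : Interp 𝓣 (nat ∷ Γ)
    𝓘ₙ = subᵢ 𝓣 (v₀ ∷ []) (bounding 𝓣 w)

    ⟨𝓘ₙ⟩∈ : ∀ m t (γ : TTms Δ Γ) (B : TTms Δ []) → ⟨ 𝓘ₙ ⟩∈ (m ∷ []) B (t ∷ γ) ≡ (t ≤ m)
    ⟨𝓘ₙ⟩∈ m t γ [] = trans (⟨⟩∈-at 𝓘ₙ (m ∷ []) [] (t ∷ γ))
      (trans (⟨subᵢ⟩ (v₀ ∷ []) (bounding 𝓣 w) _ _ _)
        (trans (⟨⟩-at (bounding 𝓣 w) _ _ _) (cong₂ _≤_ (subᵗ-ids t) (subᵗ-ids m))))

    -- Here the bound `m` changes from a positive witness of the guard to a negative witness of the
    -- implication. The guard has no negative witnesses, so its block `∀∈` is empty.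
    ⟨𝓘ₙ⊃⟩ : (Z : Interp 𝓣 (nat ∷ Γ)) → ∀ fg m d t (γ : TTms Δ Γ) →
            ⟨ _⊃ᵢ_ 𝓣 𝓘ₙ Z ⟩ fg (m ∷ d) (t ∷ γ) ≡
            (t ≤ m ⊃ ⟨ Z ⟩ (apps (nat ∷ []) (++⁻ˡ (map (nat ⇒_) (pos Z)) fg) (m ∷ [])) d (t ∷ γ))
    ⟨𝓘ₙ⊃⟩ Z fg m d t γ = trans (⟨⊃⟩ 𝓘ₙ Z fg (m ∷ d) (t ∷ γ)) (cong₂ _⊃_ (⟨𝓘ₙ⟩∈ m t γ _) refl)

    module _ {Γ NB NC : List (Type Base)} {σ : Type Base}
             (nB : All Wit NB) (nC : All Wit NC)
             (B₀ : TFm (NB ++ σ ∷ Γ)) (C₀ : TFm (NC ++ nat ∷ σ ∷ Γ)) where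

      private
        B : Interp 𝓣 (σ ∷ Γ)
        B = interp [] nB B₀
        C : Interp 𝓣 (nat ∷ σ ∷ Γ)
        C = interp [] nC C₀
        B′ : Interp 𝓣 (σ ∷ nat ∷ Γ)
        B′ = subᵢ 𝓣 (lift wk₁) B
        C′ : Interp 𝓣 (nat ∷ σ ∷ nat ∷ Γ)
        C′ = subᵢ 𝓣 (lift (lift wk₁)) C
        le : Interp 𝓣 (nat ∷ σ ∷ nat ∷ Γ)
        le = _≈ᵢ_ 𝓣 (monus v₀ v₂) (con zero)

        bounded : Interp 𝓣 (σ ∷ nat ∷ Γ)
        bounded = matrixᵢ B′ le C′
        unbounded : Interp 𝓣 (σ ∷ Γ)
        unbounded = matrixᵢ B 𝓘ₙ C
        premise conclusion : Interp 𝓣 Γ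
        premise    = ∀ᵢ 𝓣 (_⊃ᵢ_ 𝓣 𝓘ₙ (∃ᵢ 𝓣 bounded))
        conclusion = ∃ᵢ 𝓣 unbounded

      ⟨le⟩∈ : ∀ n x k (γ : TTms Δ Γ) (D : TTms Δ []) →
              ⟨ le ⟩∈ [] D (n ∷ x ∷ k ∷ γ) ≡ (n ≤ k)
      ⟨le⟩∈ n x k γ [] = trans (⟨⟩∈-at le [] [] (n ∷ x ∷ k ∷ γ))
        (trans (⟨⟩-at le _ _ _) (cong₂ _≤_ (subᵗ-ids n) (subᵗ-ids k)))

      ⟨le⊃⟩ : ∀ e n x k (γ : TTms Δ Γ) →
              ⟨ _⊃ᵢ_ 𝓣 le C′ ⟩ [] e (n ∷ x ∷ k ∷ γ) ≡ (n ≤ k ⊃ ⟨ C ⟩ [] e (n ∷ x ∷ γ))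
      ⟨le⊃⟩ e n x k γ = trans (⟨⊃⟩ le C′ [] e (n ∷ x ∷ k ∷ γ)) (cong₂ _⊃_ (⟨le⟩∈ n x k γ _)
        (trans (⟨subᵢ⟩ (lift (lift wk₁)) C [] e (n ∷ x ∷ k ∷ γ)) (⟨⟩-cong C refl refl
          (trans (subˢ-lift n (x ∷ k ∷ γ) (lift wk₁)) (cong (n ∷_)
            (trans (subˢ-lift x (k ∷ γ) wk₁) (cong (x ∷_) (subˢ-wk₁ k γ))))))))

      -- `map⁻` indexes the sets by the types of their elements, so that `middle` finds `M` at the
      -- place of `nat`.
      bound : TTms Δ (map _* (NB ++ nat ∷ NC)) → TTm Δ nat
      bound D = max′ (middle NB (map⁻ D))

      rest : TTms Δ (map _* (NB ++ nat ∷ NC)) → TTms Δ (map _* (NB ++ NC))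
      rest D = map⁺ (remove NB (map⁻ D))

      subᵗ-bound : (γ : TTms Ξ Δ) → ∀ D → subᵗ γ (bound D) ≡ bound (subˢ γ D)
      subᵗ-bound γ D = cong max′ (trans (map-middle (subᵗ γ) NB (map⁻ D))
        (cong (middle NB) (map-map⁻ (subᵗ γ) D)))

      subˢ-rest : (γ : TTms Ξ Δ) → ∀ D → subˢ γ (rest D) ≡ rest (subˢ γ D)
      subˢ-rest γ D = trans (map-map⁺ (subᵗ γ) (remove NB (map⁻ D))) (cong map⁺
        (trans (map-remove (subᵗ γ) NB (map⁻ D)) (cong (remove NB) (map-map⁻ (subᵗ γ) D))))

      bounded⇒unbounded : ∀ {x} {γ : TTms Δ Γ} {b D} →
        Mems (Δ ∣ Φ ⊢_) (neg-wit unbounded) b D →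
        Δ ∣ Φ ⊢ ⟨ bounded ⟩∈ [] (rest D) (x ∷ bound D ∷ γ) →
        Δ ∣ Φ ⊢ ⟨ unbounded ⟩ [] b (x ∷ γ)
      bounded⇒unbounded {x = x} {γ} {b} {D} ms d =
        cast (sym (⟨∧⟩ B (∀ᵢ 𝓣 (_⊃ᵢ_ 𝓣 𝓘ₙ C)) [] b (x ∷ γ))) (∧-I
          (cast (trans (⟨subᵢ⟩ (lift wk₁) B [] _ (x ∷ k ∷ γ)) (⟨⟩-cong B refl (++⁻ˡ-remove NB b)
                  (trans (subˢ-lift x (k ∷ γ) wk₁) (cong (x ∷_) (subˢ-wk₁ k γ)))))
            (∧-Eˡ both))
          (cast (cong (λ c → ⟨ ∀ᵢ 𝓣 (_⊃ᵢ_ 𝓣 𝓘ₙ C) ⟩ [] c (x ∷ γ)) (++⁻ʳ-remove NB b))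
            (cast (sym (trans (⟨∀⟩ (_⊃ᵢ_ 𝓣 𝓘ₙ C) [] (m ∷ e) (x ∷ γ))
                (cong (∀′ tt) (⟨𝓘ₙ⊃⟩ C [] (subᵗ wk₁ m) (subˢ wk₁ e) v₀ (subˢ wk₁ (x ∷ γ))))))
              -- `m` is the component of `b` lying in `M`, hence m ≤ max M = k, and n ≤ m gives n ≤
              -- k.
              (∀≤-mono (max-upper (Mems-middle nB ms))
                (cast (trans (⟨∀⟩ (_⊃ᵢ_ 𝓣 le C′) [] e (x ∷ k ∷ γ))
                    (cong (∀′ tt) (⟨le⊃⟩ (subˢ wk₁ e) v₀ (subᵗ wk₁ x) (subᵗ wk₁ k) (subˢ wk₁ γ))))
                  (∧-Eʳ both))))))
        where
        k m : TTm _ nat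
        k = bound D
        m = middle NB b
        e : TTms _ NC
        e = ++⁻ʳ NB (remove NB b)
        both : _ ∣ _ ⊢ _
        both = cast (⟨∧⟩ B′ (∀ᵢ 𝓣 (_⊃ᵢ_ 𝓣 le C′)) [] (remove NB b) (x ∷ k ∷ γ))
          (⟨⟩∈-E bounded d (Mems-remove nB ms))

      -- ({D}, {max M}, {E}) for the triple (D, M, E), with max M put first.
      witness : TTms Δ (neg conclusion) → TTms Δ (map _* (neg premise))
      witness D = singles (neg-wit premise) (bound D ∷ rest D)

      subˢ-witness : (γ : TTms Ξ Δ) → ∀ D → subˢ γ (witness D) ≡ witness (subˢ γ D)
      subˢ-witness γ D = trans (subˢ-singles γ (neg-wit premise) (bound D ∷ rest D))
        (cong (singles (neg-wit premise)) (cong₂ _∷_ (subᵗ-bound γ D) (subˢ-rest γ D)))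

      premise⇒conclusion : ∀ {D} {γ : TTms Δ Γ} →
        Δ ∣ Φ ⊢ ⟨ premise ⟩∈ [] (witness D) γ → Δ ∣ Φ ⊢ ⟨ conclusion ⟩ [] D γ
      premise⇒conclusion {D = D} {γ} d = ∃-E
        (cast (⟨∃⟩ bounded [] (rest D) (k ∷ γ))
          -- `k` is used twice, as the number and as the witness bounding it, which leaves the guard
          -- k ≤ k.
          (⊃-E (cast (⟨𝓘ₙ⊃⟩ (∃ᵢ 𝓣 bounded) [] k (rest D) k γ)
                 (⟨∀⟩-E (_⊃ᵢ_ 𝓣 𝓘ₙ (∃ᵢ 𝓣 bounded)) (⟨⟩∈-E premise d (Mems-singles _ _)) k))
               ≤-refl))
        (cast (sym (sub-⟨⟩ conclusion wk₁ [] D γ)) (⟨∃⟩-I unbounded v₀ (⟨⟩∈-I unbounded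
          -- Inside the prefix over `N` the memberships in `D` and the property of x, which concerns
          -- the full sets `rest D`, are all hypotheses; `H-eq` moves the two weakenings of the
          -- latter into `bound` and `rest`.
          (bounded⇒unbounded (Mems-hyp (hyps-Mems (neg-wit unbounded) (subˢ wk₁ D)))
            (cast H-eq (hyp (hyps-wks (neg-wit unbounded) (subˢ wk₁ D) (here refl))))))))
        where
        k : TTm _ nat
        k = bound D
        N : List (Type Base)
        N = neg unbounded
        Mems-hyp : ∀ {Δ Φ} {Θ} {ws : All Wit Θ} {bs : TTms Δ Θ} {Bs} →
                   Mems (_∈ Φ) ws bs Bs → Mems (Δ ∣ Φ ⊢_) ws bs Bs
        Mems-hyp []       = []
        Mems-hyp (m ∷ ms) = hyp m ∷ Mems-hyp ms
        H-eq : sub (wks N) (⟨ bounded ⟩∈ [] (subˢ wk₁ (rest D)) (lift (k ∷ γ))) ≡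
               ⟨ bounded ⟩∈ [] (rest (subˢ (wks N) (subˢ wk₁ D)))
                 (subᵗ (wks N) v₀ ∷ bound (subˢ (wks N) (subˢ wk₁ D)) ∷ subˢ (wks N) (subˢ wk₁ γ))
        H-eq = trans (sub-⟨⟩∈ bounded (wks N) _ _ _) (⟨⟩∈-cong bounded refl
          (trans (cong (subˢ (wks N)) (subˢ-rest wk₁ D)) (subˢ-rest (wks N) (subˢ wk₁ D)))
          (cong (λ z → subᵗ (wks N) v₀ ∷ z ∷ subˢ (wks N) (subˢ wk₁ γ))
            (trans (cong (subᵗ (wks N)) (subᵗ-bound wk₁ D)) (subᵗ-bound (wks N) (subˢ wk₁ D)))))

      Realized-collection : Realized (_⊃ᵢ_ 𝓣 premise conclusion)
      -- Neither side has positive witnesses, so `f` is empty and `g` depends only on the sets `D`.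
      Realized-collection = Realized-⊃ premise conclusion [] (witness (++⁻ˡ (neg conclusion) ids))
        λ { [] D γ → ⊃-I (premise⇒conclusion (cast (cong (λ z → ⟨ premise ⟩∈ [] z γ)
              (trans (subˢ-witness (++⁺ D []) (++⁻ˡ (neg conclusion) ids))
                     (cong witness (subˢ-fst D []))))
              (hyp (here refl)))) }

      -- These equations and their consequences all hold by refl, but Interp has
      -- η, so that refl compares the unfolded bodies, whose size is exponential
      -- in the depth of the interpretation; hence the small steps.
      premise-≡ : ∀ {J Z} → J ≡ 𝓘ₙ → Z ≡ bounded → ∀ᵢ 𝓣 (_⊃ᵢ_ 𝓣 J (∃ᵢ 𝓣 Z)) ≡ premise
      premise-≡ refl refl = refl

      conclusion-≡ : ∀ {Y} → Y ≡ unbounded → ∃ᵢ 𝓣 Y ≡ conclusion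
      conclusion-≡ refl = refl

      bounded-≡ : ∀ {X J Y} → X ≡ B′ → J ≡ le → Y ≡ C′ → matrixᵢ X J Y ≡ bounded
      bounded-≡ refl refl refl = refl

      unbounded-≡ : ∀ {X J Y} → X ≡ B → J ≡ 𝓘ₙ → Y ≡ C → matrixᵢ X J Y ≡ unbounded
      unbounded-≡ refl refl refl = refl

      Realized-collection′ : ∀ {J Z Y} → J ≡ 𝓘ₙ → Z ≡ bounded → Y ≡ unbounded →
                             Realized (collectionᵢ J Z Y)
      Realized-collection′ {J} {Z} {Y} k z y = subst Realized
        (sym (cong₂ (_⊃ᵢ_ 𝓣) {x = ∀ᵢ 𝓣 (_⊃ᵢ_ 𝓣 J (∃ᵢ 𝓣 Z))} {y = premise}
                             {u = ∃ᵢ 𝓣 Y} {v = conclusion}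
          (premise-≡ k z) (conclusion-≡ y)))
        Realized-collection

  -- With `B` and `C` as variables, the equations on `pos` can be matched with `refl`, after which
  -- all lists of witness types compute.
  Realized-collectionᵢ : ∀ {w J₁ J₂ L B′ C′} (B : Interp 𝓣 (σ ∷ Γ)) (C : Interp 𝓣 (nat ∷ σ ∷ Γ)) →
    J₁ ≡ 𝓘ₙ w → J₂ ≡ 𝓘ₙ w → L ≡ _≈ᵢ_ 𝓣 (monus v₀ v₂) (con zero) →
    pos B ≡ [] → pos C ≡ [] →
    B′ ≡ subᵢ 𝓣 (lift wk₁) B → C′ ≡ subᵢ 𝓣 (lift (lift wk₁)) C →
    Realized (collectionᵢ J₁ (matrixᵢ B′ L C′) (matrixᵢ B J₂ C))
  Realized-collectionᵢ {w = w} (interp [] nB B₀) (interp [] nC C₀) k₁ k₂ l refl refl b c =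
    Realized-collection′ w nB nC B₀ C₀ k₁
      (bounded-≡ w nB nC B₀ C₀ b l c) (unbounded-≡ w nB nC B₀ C₀ refl k₂ refl)

  -- From interpretations back to formulas

  module _ (β : BaseInterpretation 𝓣) where
    open SourceTheory 𝓢 using (IFm; SFm; Sort; 𝓘; sort-nat; relativize)

    private
      𝒰 : IFm Γ → Interp 𝓣 Γ
      𝒰 = 𝒰⟦_⟧ 𝓣 β

    𝒰-matrix : ∀ .(s : Sort σ) (B : IFm Γ) J C →
               𝒰 (B ∧ ∀′ s (J ⊃ C)) ≡ matrixᵢ (𝒰 B) (𝒰 J) (𝒰 C)
    𝒰-matrix s B J C = refl

    𝒰-collection : ∀ .(n : Sort nat) .(s : Sort σ) (J : IFm (nat ∷ Γ)) Z Y →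
                   𝒰 (∀′ n (J ⊃ ∃′ s Z) ⊃ ∃′ s Y) ≡ collectionᵢ (𝒰 J) (𝒰 Z) (𝒰 Y)
    𝒰-collection n s J Z Y = refl

    Realized-𝒰-collection : ∀ {w} .(n : Sort nat) .(s : Sort σ) J₁ J₂ L B′ C′ (B : IFm (σ ∷ Γ)) C →
      𝒰 J₁ ≡ 𝓘ₙ w → 𝒰 J₂ ≡ 𝓘ₙ w → 𝒰 L ≡ _≈ᵢ_ 𝓣 (monus v₀ v₂) (con zero) →
      pos (𝒰 B) ≡ [] → pos (𝒰 C) ≡ [] →
      𝒰 B′ ≡ subᵢ 𝓣 (lift wk₁) (𝒰 B) → 𝒰 C′ ≡ subᵢ 𝓣 (lift (lift wk₁)) (𝒰 C) →
      Realized (𝒰 (∀′ n (J₁ ⊃ ∃′ s (B′ ∧ ∀′ n (L ⊃ C′))) ⊃ ∃′ s (B ∧ ∀′ n (J₂ ⊃ C))))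
    Realized-𝒰-collection n s J₁ J₂ L B′ C′ B C j₁ j₂ l B-pos C-pos b c = subst Realized
      (sym 𝒰-≡) (Realized-collectionᵢ (𝒰 B) (𝒰 C) j₁ j₂ l B-pos C-pos b c)
      where
      𝒰-≡ : 𝒰 (∀′ n (J₁ ⊃ ∃′ s (B′ ∧ ∀′ n (L ⊃ C′))) ⊃ ∃′ s (B ∧ ∀′ n (J₂ ⊃ C))) ≡
            collectionᵢ (𝒰 J₁) (matrixᵢ (𝒰 B′) (𝒰 L) (𝒰 C′)) (matrixᵢ (𝒰 B) (𝒰 J₂) (𝒰 C))
      𝒰-≡ = trans (𝒰-collection n s J₁ (B′ ∧ ∀′ n (L ⊃ C′)) (B ∧ ∀′ n (J₂ ⊃ C)))
        (cong₂ (collectionᵢ (𝒰 J₁)) {x = 𝒰 (B′ ∧ ∀′ n (L ⊃ C′))} {y = matrixᵢ (𝒰 B′) (𝒰 L) (𝒰 C′)}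
               {u = 𝒰 (B ∧ ∀′ n (J₂ ⊃ C))} {v = matrixᵢ (𝒰 B) (𝒰 J₂) (𝒰 C)}
          (𝒰-matrix n B′ L C′) (𝒰-matrix n B J₂ C))

    -- With both formulas explicit, their equality is checked on the small syntax trees and not on
    -- the interpretations.
    Realized-resp : (A A′ : IFm Γ) → A ≡ A′ → Realized (𝒰 A) → Realized (𝒰 A′)
    Realized-resp A A′ refl r = r

    lift-≡ : ∀ {Γ Δ σ} (γ : Tms 𝓢.sig Δ Γ) {δ : TTms Δ Γ} → All.map embed γ ≡ δ →
             All.map embed (lift {σ = σ} γ) ≡ lift δ
    lift-≡ γ e = trans (embed-lift γ) (cong lift e)

    weaken : ∀ {Γ Δ} (D : SFm Γ) (γ : Tms 𝓢.sig Δ Γ) {δ : TTms Δ Γ} → All.map embed γ ≡ δ →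
             𝒰 (relativize (sub γ D)) ≡ subᵢ 𝓣 δ (𝒰 (relativize D))
    weaken D γ refl = trans (cong 𝒰 (relativize-sub 𝓢 γ D)) (𝒰-sub β γ (relativize D))

    Realized-boundedCollection : UsesBounding 𝓣 β → ∀ (s : Sort σ) (B : SFm (σ ∷ Γ)) C →
      NoPositive𝓘Witnesses 𝓣 β B → NoPositive𝓘Witnesses 𝓣 β C →
      Realized (𝒰 (relativize (boundedCollection 𝓢 s B C)))
    Realized-boundedCollection (w , β-nat) s B C B-pos C-pos =
      Realized-resp (∀′ sort-nat (J ⊃ ∃′ s (B″ ∧ ∀′ sort-nat (L ⊃ C″))) ⊃
        ∃′ s (relativize B ∧ ∀′ sort-nat (J ⊃ relativize C)))
        (relativize (boundedCollection 𝓢 s B C)) A-≡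
        (Realized-𝒰-collection {w = w} sort-nat s J J L B″ C″ (relativize B) (relativize C)
          (cong (subᵢ 𝓣 (v₀ ∷ [])) β-nat) (cong (subᵢ 𝓣 (v₀ ∷ [])) β-nat) refl B-pos C-pos
          (weaken B (lift wk₁) (lift-≡ wk₁ embed-wk₁))
          (weaken C (lift (lift wk₁)) (lift-≡ (lift wk₁) (lift-≡ wk₁ embed-wk₁))))
      where
      B″ : IFm _
      B″ = relativize (sub (lift wk₁) B)
      C″ : IFm _
      C″ = relativize (sub (lift (lift wk₁)) C)
      J : ∀ {Γ} → IFm (nat ∷ Γ)
      J = rel (𝓘 sort-nat) (v₀ ∷ [])
      L : IFm _
      L = v₀ ≤ v₂
      A-≡ : (∀′ sort-nat (J ⊃ ∃′ s (B″ ∧ ∀′ sort-nat (L ⊃ C″))) ⊃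
             ∃′ s (relativize B ∧ ∀′ sort-nat (J ⊃ relativize C))) ≡
            relativize (boundedCollection 𝓢 s B C)
      A-≡ = refl

    -- The realizer of `A` is uniform in the free variables, so it may ignore the witnesses of their
    -- guards 𝓘.
    Realized⇒∀𝓘-Interpretable : (ss : All Sort Γ) (A : IFm Γ) →
                                Realized (𝒰 A) → 𝒰-Interpretable 𝓣 β (𝓢.∀𝓘 ss A)
    Realized⇒∀𝓘-Interpretable ss A r = Realized⇒𝒰-Interpretable β (𝓢.∀𝓘 ss A)
      (Realized-close β ss (𝓢.𝓘* ss ids ⊃ A) (Realized-⊃-const (𝒰 (𝓢.𝓘* ss ids)) (𝒰 A) r))

theorem9p14 : {Base : Set} (𝓢 : SourceTheory Base) (𝓣 : TargetTheory 𝓢) (β : BaseInterpretation 𝓣) →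
    UsesBounding 𝓣 β →
    let open SourceTheory 𝓢 in
    ∀ {Γ} (ss : All Sort Γ) {σ} (s : Sort σ) (B : SFm (σ ∷ Γ)) →
    SemiUniform 𝓣 β ss s B →
    (C : SFm (nat ∷ σ ∷ Γ)) →
    NoPositive𝓘Witnesses 𝓣 β C →
    𝓘-Interpretable 𝓣 β ss (boundedCollection 𝓢 s B C)
theorem9p14 𝓢 𝓣 β bounded ss s B (_ , B-pos) C C-pos =
  Realized⇒∀𝓘-Interpretable 𝓣 β ss (SourceTheory.relativize 𝓢 (boundedCollection 𝓢 s B C))
    (Realized-boundedCollection 𝓣 β bounded s B C B-pos C-pos)
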